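{- Let $d\ge 3$ be an integer, let $c\ge 1$ be the fixed constant described in the context, and let $\lambda\ge 2$ be an arbitrary (arbitrarily large, but fixed) integer. If for every $n\ge 1$ there is a universal exploration sequence (UES) of length $O(n^c)$ for $d$-regular graphs of size at most $n$, then there exists an infinite strongly universal exploration sequence (SUES) for $d$-regular graphs with cover time $$p(n)=O\bigl(n^{c(1+\frac1\lambda)}\bigr).$$ Moreover, such a SUES can be constructed deterministically in polynomial time, i.e. there is a deterministic algorithm which, given $N$, outputs the first $N$ symbols of the sequence in time polynomial in $N$.
   Context: All graphs are finite, connected and undirected; the size of a graph is its number of vertices. In a $d$-regular graph the edges incident to each vertex are numbered $0,1,\dots,d-1$ (a local numbering at each vertex; an edge may have different numbers at its two endpoints). Walks. Let $G=(V,E)$ be a $d$-regular graph with such a numbering. A sequence $\tau_1\tau_2\cdots\tau_k\in\{0,1,\dots,d-1\}^k$ and a starting (directed) edge $e_0=(v_{ -1},v_0)$ define a walk $v_{ -1},v_0,\dots,v_k$ as follows: for $1\le i\le k$, if $e_{i-1}=(v_{i-2},v_{i-1})$ is the $s$-th edge of $v_{i-1}$, then $e_i=(v_{i-1},v_i)$ is the $(s+\tau_i \bmod d)$-th edge of $v_{i-1}$. UES. A sequence $\tau_1\cdots\tau_l\in\{0,\dots,d-1\}^l$ is a universal exploration sequence for $d$-regular graphs of size at most $n$ if for every connected $d$-regular graph on at most $n$ vertices, every numbering of its edges and every starting edge, the walk obtained visits all vertices of the graph. SUES. A possibly infinite sequence $\tau=\tau_1\tau_2\cdots$ with $\tau_i\in\{0,\dots,d-1\}$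 is a strongly universal exploration sequence for $d$-regular graphs with cover time $p(\cdot)$ if for every $n\ge1$ every contiguous subsequence of $\tau$ of length $p(n)$ is a UES for $d$-regular graphs of size at most $n$. The constant $c$. $c\ge1$ is a fixed constant from the known explicit construction of universal exploration sequences (Reingold): for every $d\ge3$ and $n\ge1$ a UES of length $O(n^c)$ for $d$-regular graphs of size at most $n$ can be constructed deterministically in time polynomial in $n$. Constants implied by $O(\cdot)$ may depend on $d$, $c$ and $\lambda$, but not on $n$. -}

module Defs where

open import Data.Bool.Base using (Bool; T; not)
open import Data.Fin.Base using (Fin; zero; suc; toℕ)
open import Data.Fin.Properties using (nonZeroIndex)
open import Data.Fin.Subset using (Subset; ∣_∣)
open import Data.Integer.Base as ℤ using (+_)
open import Data.List.Base as List using (List; []; _∷_; applyUpTo; length; replicate)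
open import Data.List.Membership.Propositional using (_∈_)
open import Data.Maybe.Base using (Maybe; just; nothing)
open import Data.Nat.Base using (ℕ; zero; suc; _+_; _*_; _^_; _≤_)
open import Data.Nat.DivMod using (_mod_)
open import Data.Product.Base using (∃-syntax; _×_; _,_; proj₁; proj₂)
open import Data.Rational.Unnormalised.Base as ℚᵘ using (ℚᵘ; 1ℚᵘ; ↥_; ↧ₙ_)
open import Data.Vec.Base as Vec using (Vec; lookup; tabulate; _[_]%=_)
open import Function.Bundles using (_↔_; Inverse)
open import Relation.Binary.Construct.Closure.ReflexiveTransitive using (Star)
open import Relation.Binary.PropositionalEquality using (_≡_)

------------------------------------------------------------------------
-- Numbered regular graphs and walks

-- Finite simple undirected graphs on m vertices.
record Graph (m : ℕ) : Set where
  field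
    adj         : Fin m → Fin m → Bool
    symmetric   : ∀ u v → T (adj u v) → T (adj v u)
    irreflexive : ∀ v → T (not (adj v v))

  Adj : Fin m → Fin m → Set
  Adj u v = T (adj u v)

  Neighbour : Fin m → Set
  Neighbour v = ∃[ u ] Adj v u

  neighbourhood : Fin m → Subset m
  neighbourhood v = tabulate (adj v)

  Connected : Set
  Connected = ∀ u v → Star Adj u v

  Regular : ℕ → Set
  Regular d = ∀ v → ∣ neighbourhood v ∣ ≡ d

  -- The numbers of an edge at its two endpoints are unrelated.
  Numbering : ℕ → Set
  Numbering d = ∀ v → Fin d ↔ Neighbour v

  record DirectedEdge : Set where
    constructor edge
    field
      source target : Fin m
      adjacent      : Adj source target

_⊕_ : ∀ {d} → Fin d → Fin d → Fin d
_⊕_ {d} s t = ((toℕ s + toℕ t) mod d) {{nonZeroIndex s}}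

module _ {m d : ℕ} (G : Graph m) (ν : Graph.Numbering G d) where
  open Graph G

  step : Fin d → DirectedEdge → DirectedEdge
  step t (edge u v uv) = edge v (proj₁ next) (proj₂ next)
    where
    s : Fin d
    s = Inverse.from (ν v) (u , symmetric u v uv)

    next : Neighbour v
    next = Inverse.to (ν v) (s ⊕ t)

  edges : List (Fin d) → DirectedEdge → List DirectedEdge
  edges []       e = e ∷ []
  edges (t ∷ ts) e = e ∷ edges ts (step t e)

  -- The vertices v₋₁, v₀, …, vₖ, where (v₋₁ , v₀) is the starting edge.
  walk : List (Fin d) → DirectedEdge → List (Fin m)
  walk ts e = DirectedEdge.source e ∷ List.map DirectedEdge.target (edges ts e)

------------------------------------------------------------------------
-- Universal and strongly universal exploration sequences

IsUES : (d n : ℕ) → List (Fin d) → Set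
IsUES d n ts =
  ∀ m → m ≤ n → (G : Graph m) → let open Graph G in
  Connected → Regular d → (ν : Numbering d) →
  (e₀ : DirectedEdge) → ∀ v → v ∈ walk G ν ts e₀

window : ∀ {A : Set} → (ℕ → A) → (start len : ℕ) → List A
window τ start len = applyUpTo (λ i → τ (start + i)) len

-- Infinite sequences only.
IsSUES : (d : ℕ) → (ℕ → Fin d) → (coverTime : ℕ → ℕ) → Set
IsSUES d τ p = ∀ n → 1 ≤ n → ∀ start → IsUES d n (window τ start (p n))

------------------------------------------------------------------------
-- Growth rates with real exponents

-- 1 / (k + 1)
1/1+_ : ℕ → ℚᵘ
1/1+ k = + 1 ℚᵘ./ suc k

-- Real numbers as Bishop's regular sequences; the k-th term is within
-- 1 / (k + 1) of the limit.
record ℝ : Set where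
  field
    approx  : ℕ → ℚᵘ
    regular : ∀ j k → ℚᵘ.∣ approx j ℚᵘ.- approx k ∣ ℚᵘ.≤ (1/1+ j) ℚᵘ.+ (1/1+ k)

open ℝ public

_≤ᴿ_ : ℚᵘ → ℝ → Set
q ≤ᴿ x = ∀ k → q ℚᵘ.≤ approx x k ℚᵘ.+ (1/1+ k)

_<ᴿ_ : ℝ → ℚᵘ → Set
x <ᴿ q = ∃[ k ] approx x k ℚᵘ.+ (1/1+ k) ℚᵘ.< q

-- a ≤ K · n ^ e, with both sides raised to the denominator of e.  Meant for
-- e ≥ 0 only, as the sign of e is dropped.
BoundedByPower : (a K n : ℕ) → ℚᵘ → Set
BoundedByPower a K n e = a ^ (↧ₙ e) ≤ K ^ (↧ₙ e) * n ^ ℤ.∣ ↥ e ∣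

-- f(n) = O(n ^ (c r)) for real c ≥ 0 and rational r > 0.  For n ≥ 1 the map
-- x ↦ n ^ x is continuous and nondecreasing, so f n ≤ K · n ^ (c r) holds iff
-- f n ≤ K · n ^ (q r) for every rational q > c.
_∈O[n^_·_] : (ℕ → ℕ) → ℝ → ℚᵘ → Set
f ∈O[n^ c · r ] =
  ∃[ K ] ∀ n → 1 ≤ n → ∀ q → c <ᴿ q → BoundedByPower (f n) K n (q ℚᵘ.* r)

-- u n is a UES for size at most n, and its length is O(n ^ c).
IsUESFamily : (d : ℕ) → ℝ → (ℕ → List (Fin d)) → Set
IsUESFamily d c u =
  (∀ n → 1 ≤ n → IsUES d n (u n)) × (λ n → length (u n)) ∈O[n^ c · 1ℚᵘ ]

------------------------------------------------------------------------
-- Polynomial time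

-- The machine model is a deterministic machine with finitely many stacks over
-- a finite alphabet, programmed by structured commands.  A tape is a pair of
-- stacks and a stack is a one-sided tape, so up to a constant factor the time
-- below is that of multitape Turing machines.

-- `mark' is the unary input digit, `out' carries the output letters, and `aux'
-- provides any finite number of work symbols.
data Symbol (d s : ℕ) : Set where
  mark : Symbol d s
  out  : Fin d → Symbol d s
  aux  : Fin s → Symbol d s

data Command (A : Set) (k : ℕ) : Set where
  skip   : Command A k
  push   : Fin k → A → Command A k
  pop    : Fin k → Command A k
  _⨾_    : Command A k → Command A k → Command A k
  -- branch on the top of a stack (`nothing' if the stack is empty)
  switch : Fin k → (Maybe A → Command A k) → Command A k
  -- repeat the body as long as the stack is nonempty
  while  : Fin k → Command A k → Command A k

Stacks : Set → ℕ → Set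
Stacks A k = Vec (List A) k

-- ⟨ C , σ ⟩⇓[ t ] σ′: started with stacks σ, the command C halts after t steps
-- with stacks σ′.
data ⟨_,_⟩⇓[_]_ {A : Set} {k : ℕ} :
       Command A k → Stacks A k → ℕ → Stacks A k → Set where
  skip   : ∀ {σ} → ⟨ skip , σ ⟩⇓[ 1 ] σ
  push   : ∀ {σ i a} → ⟨ push i a , σ ⟩⇓[ 1 ] (σ [ i ]%= (a ∷_))
  pop    : ∀ {σ i} → ⟨ pop i , σ ⟩⇓[ 1 ] (σ [ i ]%= List.drop 1)
  _⨾_    : ∀ {C D σ σ′ σ″ t t′} →
           ⟨ C , σ ⟩⇓[ t ] σ′ → ⟨ D , σ′ ⟩⇓[ t′ ] σ″ →
           ⟨ C ⨾ D , σ ⟩⇓[ t + t′ ] σ″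
  switch : ∀ {i B σ σ′ t} →
           ⟨ B (List.head (lookup σ i)) , σ ⟩⇓[ t ] σ′ →
           ⟨ switch i B , σ ⟩⇓[ suc t ] σ′
  done   : ∀ {i C σ} → lookup σ i ≡ [] → ⟨ while i C , σ ⟩⇓[ 1 ] σ
  loop   : ∀ {i C σ σ′ σ″ t t′ a as} → lookup σ i ≡ a ∷ as →
           ⟨ C , σ ⟩⇓[ t ] σ′ → ⟨ while i C , σ′ ⟩⇓[ t′ ] σ″ →
           ⟨ while i C , σ ⟩⇓[ suc (t + t′) ] σ″

-- Stack 0 is for input and stack 1 for output, read from the top; what is left
-- on the other stacks at the end is irrelevant.
initial : ∀ {d s} k → ℕ → Stacks (Symbol d s) (2 + k)
initial k n = replicate n mark Vec.∷ Vec.replicate (suc k) []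

output : ∀ {A k} → Stacks A (2 + k) → List A
output σ = lookup σ (suc zero)

-- The input n is given in unary, so the time is polynomial in n itself.
PolynomialTime : (d : ℕ) → (ℕ → List (Fin d)) → Set
PolynomialTime d f =
  ∃[ s ] ∃[ k ] ∃[ C ] ∃[ a ] ∃[ b ] ∀ n → ∃[ t ] ∃[ σ ]
    (⟨ C , initial {d} {s} k n ⟩⇓[ t ] σ)
    × output σ ≡ List.map out (f n)
    × t ≤ a * n ^ b + a

module Submission where

-- Symbol 0 turns a walk around, so every word u extends to a loop word, which ends
-- on the edge where it started whatever the graph.  Let q_j be a loop word that
-- begins with a UES for size B^j.  Starting from the constant sequence, insert a
-- copy of q_j after every |q_j| symbols, for j = k-1, …, 1, 0 in this order; the
-- prefixes stabilise as k grows.  Inserted loops do not disturb a walk, and each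
-- round of insertions only doubles distances, so a window of length O(2^k |q_k|)
-- contains all of q_k.  With B = 2^l the factor 2^k is the l-th root of B^k.

-- The obstacle is that one sequence has to serve all sizes: a copy of a long word is cut up by the
-- shorter words inserted later. Since an inserted loop returns to its starting edge, it can only
-- add visited vertices; so what passes from level to level is that every window of some length is a
-- UES, not that a given word occurs. The levels above `k` need no analysis, because the argument
-- for level `k` works for an arbitrary stream into which its word is inserted. Nothing is known
-- about the lengths of the given UESs from below, so each loop word is padded by pairs of zeros to
-- at least `B ^ j` symbols; this makes prefixes stabilise at a computable level. For a size
-- `N = B ^ k` the windows have length of order N^(1/l) N^c, which is at most N^(c (1 + 1/l))
-- because c is at least 1. Rounding a size up to a power of `B` costs a constant factor. As c is
-- real, everything is estimated for rational exponents x/y above c, after raising to the power y,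
-- and the constant must not depend on x/y. The program never computes positions. It weaves finite
-- words held on stacks, and its only counters are unary.

module Walks where
  open import Defs
  open import Data.Bool.Properties using (T-irrelevant)
  open import Data.Fin.Base using (Fin; zero; suc; toℕ)
  open import Data.Fin.Properties using (toℕ-fromℕ<; toℕ<n; toℕ-injective; toℕ≤n)
  open import Data.List.Base using (List; []; _∷_; _++_; map; reverse)
  open import Data.List.Membership.Propositional using (_∈_)
  open import Data.List.Properties using (ʳ++-defn)
  open import Data.List.Relation.Unary.Any using (here; there)
  open import Data.Nat.Base using (ℕ; zero; suc; _+_; _∸_; _≤_)
  open import Data.Nat.DivMod
  open import Data.Nat.Properties
  open import Data.Product.Base using (_,_; proj₁; proj₂)
  open import Data.Sum.Base using (_⊎_; inj₁; inj₂)
  open import Function.Base using (_∘_)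
  open import Function.Bundles using (Inverse)
  open import Relation.Binary.PropositionalEquality

  -- Retracing walks, and words that lead back to the starting edge

  neg : ∀ {d} → Fin (suc d) → Fin (suc d)
  neg {d} t = (suc d ∸ toℕ t) mod suc d

  toℕ-mod : ∀ m n → toℕ (m mod suc n) ≡ m % suc n
  toℕ-mod m n = toℕ-fromℕ< (m%n<n m (suc n))

  ⊕-identityʳ : ∀ {d} (s : Fin (suc d)) → s ⊕ zero ≡ s
  ⊕-identityʳ {d} s = toℕ-injective (begin
    toℕ (s ⊕ zero)           ≡⟨ toℕ-mod (toℕ s + 0) d ⟩
    (toℕ s + 0) % suc d      ≡⟨ cong (_% suc d) (+-identityʳ (toℕ s)) ⟩
    toℕ s % suc d            ≡⟨ m<n⇒m%n≡m (toℕ<n s) ⟩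
    toℕ s                    ∎)
    where open ≡-Reasoning

  ⊕-neg : ∀ {d} (s t : Fin (suc d)) → (s ⊕ t) ⊕ neg t ≡ s
  ⊕-neg {d} s t = toℕ-injective (begin
    toℕ ((s ⊕ t) ⊕ neg t)                             ≡⟨ toℕ-mod (toℕ (s ⊕ t) + toℕ (neg t)) d ⟩
    (toℕ (s ⊕ t) + toℕ (neg t)) % D                   ≡⟨ cong₂ (λ x y → (x + y) % D) (toℕ-mod (toℕ s + toℕ t) d) (toℕ-mod (D ∸ toℕ t) d) ⟩
    ((toℕ s + toℕ t) % D + (D ∸ toℕ t) % D) % D       ≡⟨ %-distribˡ-+ (toℕ s + toℕ t) (D ∸ toℕ t) D ⟨
    (toℕ s + toℕ t + (D ∸ toℕ t)) % D                 ≡⟨ cong (_% D) (+-assoc (toℕ s) (toℕ t) (D ∸ toℕ t)) ⟩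
    (toℕ s + (toℕ t + (D ∸ toℕ t))) % D               ≡⟨ cong (λ x → (toℕ s + x) % D) (m+[n∸m]≡n (toℕ≤n t)) ⟩
    (toℕ s + D) % D                                   ≡⟨ [m+n]%n≡m%n (toℕ s) D ⟩
    toℕ s % D                                         ≡⟨ m<n⇒m%n≡m (toℕ<n s) ⟩
    toℕ s                                             ∎)
    where
    open ≡-Reasoning
    D : ℕ
    D = suc d

  inverse : ∀ {d} → List (Fin (suc d)) → List (Fin (suc d))
  inverse ts = reverse (map neg ts)

  module _ {m : ℕ} (G : Graph m) where
    open Graph G

    flip : DirectedEdge → DirectedEdge
    flip (edge u v uv) = edge v u (symmetric u v uv)

    -- Adjacency proofs are unique, so the endpoints determine the edge.
    edge-cong : ∀ {u v w uv uw} → v ≡ w → edge u v uv ≡ edge u w uw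
    edge-cong {u} {v} refl = cong (edge u v) (T-irrelevant _ _)

    flip-involutive : ∀ e → flip (flip e) ≡ e
    flip-involutive (edge u v uv) = cong (edge u v) (T-irrelevant _ uv)

  module _ {m d : ℕ} (G : Graph m) (ν : Graph.Numbering G (suc d)) where
    open Graph G
    open ≡-Reasoning

    run : List (Fin (suc d)) → DirectedEdge → DirectedEdge
    run []       e = e
    run (t ∷ ts) e = run ts (step G ν t e)

    run-++ : ∀ xs ys e → run (xs ++ ys) e ≡ run ys (run xs e)
    run-++ []       ys e = refl
    run-++ (x ∷ xs) ys e = run-++ xs ys (step G ν x e)

    -- The next edge starts where the current one ends, so the walk of `x ∷ xs` is the source of `e`
    -- followed by the walk of `xs` from the next edge. This is why `there` suffices in the
    -- inductions on `xs`.
    walk-++⁻ : ∀ xs ys e {v} → v ∈ walk G ν (xs ++ ys) e →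
               v ∈ walk G ν xs e ⊎ v ∈ walk G ν ys (run xs e)
    walk-++⁻ []       ys e v∈       = inj₂ v∈
    walk-++⁻ (x ∷ xs) ys e (here p) = inj₁ (here p)
    walk-++⁻ (x ∷ xs) ys e (there v∈) with walk-++⁻ xs ys (step G ν x e) v∈
    ... | inj₁ v∈xs = inj₁ (there v∈xs)
    ... | inj₂ v∈ys = inj₂ v∈ys

    walk-++⁺ʳ : ∀ xs ys e {v} → v ∈ walk G ν ys (run xs e) → v ∈ walk G ν (xs ++ ys) e
    walk-++⁺ʳ []       ys e v∈ = v∈
    walk-++⁺ʳ (x ∷ xs) ys e v∈ = there (walk-++⁺ʳ xs ys (step G ν x e) v∈)

    walk-++⁺ˡ : ∀ xs ys e {v} → v ∈ walk G ν xs e → v ∈ walk G ν (xs ++ ys) e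
    walk-++⁺ˡ []       []       e v∈                = v∈
    walk-++⁺ˡ []       (y ∷ ys) e (here p)          = here p
    walk-++⁺ˡ []       (y ∷ ys) e (there (here p))  = there (here p)
    walk-++⁺ˡ (x ∷ xs) ys       e (here p)          = here p
    walk-++⁺ˡ (x ∷ xs) ys       e (there v∈)        = there (walk-++⁺ˡ xs ys (step G ν x e) v∈)

    step-from : ∀ t {u v uv} (s : Fin (suc d)) →
                Inverse.from (ν v) (u , symmetric u v uv) ⊕ t ≡ s →
                step G ν t (edge u v uv) ≡ edge v (proj₁ (Inverse.to (ν v) s)) (proj₂ (Inverse.to (ν v) s))
    step-from t s refl = refl

    -- Offset zero selects the edge by which the walk has just arrived.
    step-zero : ∀ e → step G ν zero e ≡ flip G e
    step-zero (edge u v uv) = begin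
      step G ν zero (edge u v uv)  ≡⟨ step-from zero s (⊕-identityʳ s) ⟩
      edge v _ _                   ≡⟨ edge-cong G (cong proj₁ (Inverse.strictlyInverseˡ (ν v) (u , symmetric u v uv))) ⟩
      edge v u _                   ∎
      where
      s : Fin (suc d)
      s = Inverse.from (ν v) (u , symmetric u v uv)

    -- After turning around, the walk arrives at `v` by the edge with number `s ⊕ t`; the offset
    -- `neg t` then selects number `s`, the edge to `u`.
    step-neg : ∀ t e → step G ν (neg t) (flip G (step G ν t e)) ≡ flip G e
    step-neg t (edge u v uv) = begin
      step G ν (neg t) (flip G (step G ν t (edge u v uv)))
        ≡⟨ step-from (neg t) s label ⟩
      edge v _ _
        ≡⟨ edge-cong G (cong proj₁ (Inverse.strictlyInverseˡ (ν v) (u , symmetric u v uv))) ⟩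
      edge v u _
        ∎
      where
      s : Fin (suc d)
      s = Inverse.from (ν v) (u , symmetric u v uv)

      next : Neighbour v
      next = Inverse.to (ν v) (s ⊕ t)

      label : Inverse.from (ν v) (proj₁ next , symmetric (proj₁ next) v (symmetric v (proj₁ next) (proj₂ next))) ⊕ neg t ≡ s
      label = begin
        Inverse.from (ν v) (proj₁ next , _) ⊕ neg t  ≡⟨ cong (λ a → Inverse.from (ν v) (proj₁ next , a) ⊕ neg t) (T-irrelevant _ _) ⟩
        Inverse.from (ν v) next ⊕ neg t              ≡⟨ cong (_⊕ neg t) (Inverse.strictlyInverseʳ (ν v) (s ⊕ t)) ⟩
        (s ⊕ t) ⊕ neg t                              ≡⟨ ⊕-neg s t ⟩
        s                                            ∎

    run-inverse : ∀ ts e → run (inverse ts) (flip G (run ts e)) ≡ flip G e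
    run-inverse []       e = refl
    run-inverse (t ∷ ts) e = begin
      run (inverse (t ∷ ts)) (flip G (run ts e′))                ≡⟨ cong (λ w → run w (flip G (run ts e′))) (ʳ++-defn (map neg ts)) ⟩
      run (inverse ts ++ neg t ∷ []) (flip G (run ts e′))        ≡⟨ run-++ (inverse ts) _ _ ⟩
      step G ν (neg t) (run (inverse ts) (flip G (run ts e′)))   ≡⟨ cong (step G ν (neg t)) (run-inverse ts e′) ⟩
      step G ν (neg t) (flip G e′)                               ≡⟨ step-neg t e ⟩
      flip G e                                                   ∎
      where
      e′ : DirectedEdge
      e′ = step G ν t e

    run-00 : ∀ ts e → run (zero ∷ zero ∷ ts) e ≡ run ts e
    run-00 ts e = cong (run ts) (begin
      step G ν zero (step G ν zero e)  ≡⟨ step-zero _ ⟩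
      flip G (step G ν zero e)         ≡⟨ cong (flip G) (step-zero e) ⟩
      flip G (flip G e)                ≡⟨ flip-involutive G e ⟩
      e                                ∎)

  zeroPairs : ∀ {d} → ℕ → List (Fin (suc d))
  zeroPairs zero    = []
  zeroPairs (suc n) = zero ∷ zero ∷ zeroPairs n

  -- The first `zero` turns the walk around, `inverse ts` retraces it, and the second `zero`
  -- restores the original direction. The zero pairs are padding that guarantees a minimal length.
  roundTrip : ∀ {d} → List (Fin (suc d)) → ℕ → List (Fin (suc d))
  roundTrip ts n = ts ++ zero ∷ inverse ts ++ zero ∷ zeroPairs n

  IsLoop : ∀ {d} → List (Fin (suc d)) → Set
  IsLoop {d} q = ∀ {m} (G : Graph m) (ν : Graph.Numbering G (suc d)) e → run G ν q e ≡ e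

  zeroPairs-isLoop : ∀ {d} n → IsLoop {d} (zeroPairs n)
  zeroPairs-isLoop zero    G ν e = refl
  zeroPairs-isLoop (suc n) G ν e = trans (run-00 G ν (zeroPairs n) e) (zeroPairs-isLoop n G ν e)

  roundTrip-isLoop : ∀ {d} (ts : List (Fin (suc d))) n → IsLoop (roundTrip ts n)
  roundTrip-isLoop ts n G ν e = begin
    run G ν (roundTrip ts n) e
      ≡⟨ run-++ G ν ts _ e ⟩
    run G ν (inverse ts ++ zero ∷ zeroPairs n) (step G ν zero (run G ν ts e))
      ≡⟨ run-++ G ν (inverse ts) _ _ ⟩
    run G ν (zeroPairs n) (step G ν zero (run G ν (inverse ts) (step G ν zero (run G ν ts e))))
      ≡⟨ zeroPairs-isLoop n G ν _ ⟩
    step G ν zero (run G ν (inverse ts) (step G ν zero (run G ν ts e)))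
      ≡⟨ step-zero G ν _ ⟩
    flip G (run G ν (inverse ts) (step G ν zero (run G ν ts e)))
      ≡⟨ cong (flip G ∘ run G ν (inverse ts)) (step-zero G ν _) ⟩
    flip G (run G ν (inverse ts) (flip G (run G ν ts e)))
      ≡⟨ cong (flip G) (run-inverse G ν ts e) ⟩
    flip G (flip G e)
      ≡⟨ flip-involutive G e ⟩
    e ∎
    where open ≡-Reasoning

  -- A prefix merely changes the starting edge, which is arbitrary for a UES; a suffix only adds
  -- vertices.
  IsUES-infix : ∀ {d n} xs {ys : List (Fin (suc d))} zs → IsUES (suc d) n ys → IsUES (suc d) n (xs ++ ys ++ zs)
  IsUES-infix xs {ys} zs ues m m≤n G conn reg ν e v =
    walk-++⁺ʳ G ν xs (ys ++ zs) e
      (walk-++⁺ˡ G ν ys zs (run G ν xs e) (ues m m≤n G conn reg ν (run G ν xs e) v))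

  IsUES-anti : ∀ {d m n} {ts : List (Fin (suc d))} → m ≤ n → IsUES (suc d) n ts → IsUES (suc d) m ts
  IsUES-anti m≤n ues k k≤m = ues k (≤-trans k≤m m≤n)

-- Periodic insertion of words into a stream

module Streams where
  open import Defs
  open import Data.Bool.Base using (true; false; if_then_else_; T)
  open import Data.Fin.Base using (Fin; zero; suc)
  open import Data.List.Base using (List; []; _∷_; _++_; reverse; length; _ʳ++_; applyUpTo)
  open import Data.List.Membership.Propositional using (_∈_)
  open import Data.List.Properties using (++-assoc; length-++; length-ʳ++; reverse-involutive; reverse-injective)
  open import Data.Nat.Base using (ℕ; zero; suc; _+_; _*_; _∸_; _^_; _≤_; _<_; z≤n; s≤s; _<ᵇ_; NonZero)
  open import Data.Nat.DivMod
  open import Data.Nat.Divisibility using (divides-refl)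
  open import Data.Nat.Properties
  open import Data.Nat.Solver using (module +-*-Solver)
  open import Data.Product.Base using (∃-syntax; _,_)
  open import Data.Sum.Base using (inj₁; inj₂)
  open import Function.Base using (_∘_)
  open import Relation.Binary.PropositionalEquality
  open Walks

  module _ {A : Set} where

    applyUpTo-cong : ∀ {f g : ℕ → A} n → (∀ i → i < n → f i ≡ g i) → applyUpTo f n ≡ applyUpTo g n
    applyUpTo-cong zero    eq = refl
    applyUpTo-cong (suc n) eq = cong₂ _∷_ (eq 0 (s≤s z≤n)) (applyUpTo-cong n (λ i i<n → eq (suc i) (s≤s i<n)))

    applyUpTo-++ : ∀ (f : ℕ → A) m n → applyUpTo f (m + n) ≡ applyUpTo f m ++ applyUpTo (λ i → f (m + i)) n
    applyUpTo-++ f zero    n = refl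
    applyUpTo-++ f (suc m) n = cong (f 0 ∷_) (applyUpTo-++ (f ∘ suc) m n)

    window-++ : ∀ (f : ℕ → A) s m n → window f s (m + n) ≡ window f s m ++ window f (s + m) n
    window-++ f s m n = trans (applyUpTo-++ _ m n)
      (cong (window f s m ++_) (applyUpTo-cong n (λ i _ → cong f (sym (+-assoc s m i)))))

    infix 4 _≗[_]_
    _≗[_]_ : (ℕ → A) → ℕ → (ℕ → A) → Set
    f ≗[ n ] g = ∀ i → i < n → f i ≡ g i

    nth : A → List A → ℕ → A
    nth x []       i       = x
    nth x (y ∷ ys) zero    = y
    nth x (y ∷ ys) (suc i) = nth x ys i

    applyUpTo-nth : ∀ x ys → applyUpTo (nth x ys) (length ys) ≡ ys
    applyUpTo-nth x []       = refl
    applyUpTo-nth x (y ∷ ys) = cong (y ∷_) (applyUpTo-nth x ys)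

    -- The period is twice the length of `q`, so division gives each position directly. The empty
    -- word has no period; leaving `f` unchanged is a default.
    interleave : List A → (ℕ → A) → ℕ → A
    interleave []         f i = f i
    interleave q@(y ∷ ys) f i =
      if r <ᵇ a then f (i / (a + a) * a + r) else nth y q (r ∸ a)
      where
      a r : ℕ
      a = suc (length ys)
      r = i % (a + a)

    [m*n+r]%n : ∀ m n r .{{_ : NonZero n}} → r < n → (m * n + r) % n ≡ r
    [m*n+r]%n m n r r<n = trans (cong (_% n) (+-comm (m * n) r)) (trans ([m+kn]%n≡m%n r m n) (m<n⇒m%n≡m r<n))

    [m*n+r]/n : ∀ m n r .{{_ : NonZero n}} → r < n → (m * n + r) / n ≡ m
    [m*n+r]/n m n r r<n = begin
      (m * n + r) / n      ≡⟨ +-distrib-/-∣ˡ r (divides-refl m) ⟩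
      m * n / n + r / n    ≡⟨ cong₂ _+_ (m*n/n≡m m n) (m<n⇒m/n≡0 r<n) ⟩
      m + 0                ≡⟨ +-identityʳ m ⟩
      m                    ∎
      where open ≡-Reasoning

    <⇒<ᵇ≡true : ∀ {m n} → m < n → (m <ᵇ n) ≡ true
    <⇒<ᵇ≡true {m} {n} m<n with m <ᵇ n | <⇒<ᵇ m<n
    ... | true | _ = refl

    ≤⇒<ᵇ≡false : ∀ {m n} → n ≤ m → (m <ᵇ n) ≡ false
    ≤⇒<ᵇ≡false {m} {n} n≤m with m <ᵇ n in eq
    ... | false = refl
    ... | true  with () ← <⇒≱ (<ᵇ⇒< m n (subst T (sym eq) _)) n≤m

    interleave-copy : ∀ q f m r → r < length q →
                      interleave q f (m * (length q + length q) + r) ≡ f (m * length q + r)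
    interleave-copy (y ∷ ys) f m r r<a
      rewrite [m*n+r]%n m (suc (length ys) + suc (length ys)) r (<-≤-trans r<a (m≤m+n _ _))
            | [m*n+r]/n m (suc (length ys) + suc (length ys)) r (<-≤-trans r<a (m≤m+n _ _))
            | <⇒<ᵇ≡true r<a = refl

    interleave-insert : ∀ y ys f m r → r < suc (length ys) →
                        interleave (y ∷ ys) f (m * (suc (length ys) + suc (length ys)) + (suc (length ys) + r)) ≡ nth y (y ∷ ys) r
    interleave-insert y ys f m r r<a
      rewrite [m*n+r]%n m (suc (length ys) + suc (length ys)) (suc (length ys) + r) (+-monoʳ-< (suc (length ys)) r<a)
            | ≤⇒<ᵇ≡false (m≤m+n (suc (length ys)) r)
            | m+n∸m≡n (length ys) r = refl

    window-interleave-copy : ∀ q f m → window (interleave q f) (m * (length q + length q)) (length q) ≡ window f (m * length q) (length q)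
    window-interleave-copy q f m = applyUpTo-cong (length q) (interleave-copy q f m)

    window-interleave-insert : ∀ q f m → window (interleave q f) (m * (length q + length q) + length q) (length q) ≡ q
    window-interleave-insert []           f m = refl
    window-interleave-insert q@(y ∷ ys) f m = trans
      (applyUpTo-cong (length q) λ i i<a →
        trans (cong (interleave q f) (+-assoc (m * (length q + length q)) (length q) i)) (interleave-insert y ys f m i i<a))
      (applyUpTo-nth y q)

    window-interleave : ∀ q f m → window (interleave q f) (m * (length q + length q)) (length q + length q) ≡ window f (m * length q) (length q) ++ q
    window-interleave q f m = trans (window-++ (interleave q f) (m * (length q + length q)) (length q) (length q))
      (cong₂ _++_ (window-interleave-copy q f m) (window-interleave-insert q f m))

    -- Insertions move symbols of `f` only towards the back, so position `i` of the result depends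
    -- on `f` up to `i` at most.
    interleave-cong : ∀ q {f g n} → f ≗[ n ] g → interleave q f ≗[ n ] interleave q g
    interleave-cong []           eq i i<n = eq i i<n
    interleave-cong q@(y ∷ ys) eq i i<n with i % (length q + length q) <ᵇ length q
    ... | false = refl
    ... | true  = eq _ (≤-<-trans (begin
      i / (a + a) * a + i % (a + a)            ≤⟨ +-monoˡ-≤ (i % (a + a)) (*-monoʳ-≤ (i / (a + a)) (m≤m+n a a)) ⟩
      i / (a + a) * (a + a) + i % (a + a)      ≡⟨ +-comm _ (i % (a + a)) ⟩
      i % (a + a) + i / (a + a) * (a + a)      ≡⟨ m≡m%n+[m/n]*n i (a + a) ⟨
      i                                        ∎) i<n)
      where
      open ≤-Reasoning
      a : ℕ
      a = length q

    interleave-short : ∀ q f {n} → n ≤ length q → interleave q f ≗[ n ] f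
    interleave-short q f n≤a i i<n = interleave-copy q f 0 i (<-≤-trans i<n n≤a)

    expand : (ℕ → List A) → ℕ → (ℕ → A) → ℕ → A
    expand q zero    f = f
    expand q (suc k) f = expand q k (interleave (q k) f)

    expand-cong : ∀ q k {f g n} → f ≗[ n ] g → expand q k f ≗[ n ] expand q k g
    expand-cong q zero    eq = eq
    expand-cong q (suc k) eq = expand-cong q k (interleave-cong (q k) eq)

    -- A further level acts on `f` before all the others and does not touch the first `n` symbols if
    -- its word is that long; the lower levels preserve the agreement.
    expand-stable : ∀ q f {n} k j → (∀ i → k ≤ i → n ≤ length (q i)) → expand q (j + k) f ≗[ n ] expand q k f
    expand-stable q f k zero    long i i<n = refl
    expand-stable q f k (suc j) long i i<n = trans
      (expand-cong q (j + k) (interleave-short (q (j + k)) f (long (j + k) (m≤n+m k j))) i i<n)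
      (expand-stable q f k j long i i<n)

    -- The levels from `k` upwards only replace the base stream. Whatever holds for every base
    -- stream therefore holds without knowing them.
    expand-+ : ∀ q f k j → ∃[ g ] expand q (j + k) f ≡ expand q k g
    expand-+ q f k zero    = f , refl
    expand-+ q f k (suc j) = expand-+ q (interleave (q (j + k)) f) k j

    -- Says that a list is a window of `f` without mentioning its length: the length of a woven word
    -- is only estimated, never computed.
    data Follows (f : ℕ → A) : ℕ → List A → Set where
      []  : ∀ {s} → Follows f s []
      _∷_ : ∀ {s x xs} → x ≡ f s → Follows f (suc s) xs → Follows f s (x ∷ xs)

    Follows-++ : ∀ {f s xs ys} → Follows f s xs → Follows f (s + length xs) ys → Follows f s (xs ++ ys)
    Follows-++ {f} {ys = ys} [] fys = subst (λ s → Follows f s ys) (+-identityʳ _) fys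
    Follows-++ {f} {s} {ys = ys} (_∷_ {xs = xs} eq fxs) fys =
      eq ∷ Follows-++ fxs (subst (λ s → Follows f s ys) (+-suc s (length xs)) fys)

    Follows-window : ∀ f s n → Follows f s (window f s n)
    Follows-window f s zero    = []
    Follows-window f s (suc n) = cong f (+-identityʳ s) ∷
      subst (Follows f (suc s)) (applyUpTo-cong n (λ i _ → cong f (sym (+-suc s i)))) (Follows-window f (suc s) n)

    Follows⇒window : ∀ {f s xs} → Follows f s xs → xs ≡ window f s (length xs)
    Follows⇒window []         = refl
    Follows⇒window {f} {s} {x ∷ xs} (eq ∷ fxs) = cong₂ _∷_ (trans eq (cong f (sym (+-identityʳ s))))
      (trans (Follows⇒window fxs) (applyUpTo-cong (length xs) (λ i _ → cong f (sym (+-suc s i)))))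

    -- The inserted word is a zipper: p holds reversed the part which the current
    -- block has not yet counted off, and r the part which it has.
    weave : (p r : List A) → List A → List A
    weave p                 r []       = []
    weave []                r (x ∷ xs) = x ∷ weave [] r xs
    weave (b ∷ [])          r (x ∷ xs) = x ∷ b ∷ r ++ weave ((b ∷ r) ʳ++ []) [] xs
    weave (b ∷ p@(_ ∷ _)) r (x ∷ xs) = x ∷ weave p (b ∷ r) xs

    length-weave-≥ : ∀ p r xs → length xs ≤ length (weave p r xs)
    length-weave-≥ p           r []       = z≤n
    length-weave-≥ []          r (x ∷ xs) = s≤s (length-weave-≥ [] r xs)
    length-weave-≥ (b ∷ [])    r (x ∷ xs) = s≤s (m≤n⇒m≤1+n (begin
      length xs                                              ≤⟨ length-weave-≥ _ [] xs ⟩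
      length (weave ((b ∷ r) ʳ++ []) [] xs)                  ≤⟨ m≤n+m _ (length r) ⟩
      length r + length (weave ((b ∷ r) ʳ++ []) [] xs)       ≡⟨ length-++ r ⟨
      length (r ++ weave ((b ∷ r) ʳ++ []) [] xs)             ∎))
      where open ≤-Reasoning
    length-weave-≥ (b ∷ p@(_ ∷ _)) r (x ∷ xs) = s≤s (length-weave-≥ p (b ∷ r) xs)

    -- Each inserted word is paid for by the equally many symbols of its block; `length r` of these
    -- were read before `xs`.
    length-weave-≤ : ∀ p r xs → length (weave p r xs) ≤ 2 * length xs + length r
    length-weave-≤ p           r []       = z≤n
    length-weave-≤ []          r (x ∷ xs) = begin
      suc (length (weave [] r xs))           ≤⟨ s≤s (length-weave-≤ [] r xs) ⟩
      1 + (2 * length xs + length r)         ≤⟨ n≤1+n _ ⟩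
      2 + (2 * length xs + length r)         ≡⟨ cong (_+ length r) (*-suc 2 (length xs)) ⟨
      2 * length (x ∷ xs) + length r         ∎
      where open ≤-Reasoning
    length-weave-≤ (b ∷ [])    r (x ∷ xs) = begin
      2 + length (r ++ weave ((b ∷ r) ʳ++ []) [] xs)        ≡⟨ cong (2 +_) (length-++ r) ⟩
      2 + (length r + length (weave ((b ∷ r) ʳ++ []) [] xs)) ≤⟨ +-monoʳ-≤ (2 + length r) (length-weave-≤ _ [] xs) ⟩
      2 + length r + (2 * length xs + 0)                    ≡⟨ solve 2 (λ r x → con 2 :+ r :+ (con 2 :* x :+ con 0) := con 2 :* (con 1 :+ x) :+ r) refl (length r) (length xs) ⟩
      2 * length (x ∷ xs) + length r         ∎
      where
      open ≤-Reasoning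
      open +-*-Solver
    length-weave-≤ (b ∷ p@(_ ∷ _)) r (x ∷ xs) = begin
      suc (length (weave p (b ∷ r) xs))           ≤⟨ s≤s (length-weave-≤ p (b ∷ r) xs) ⟩
      1 + (2 * length xs + suc (length r))        ≡⟨ solve 2 (λ r x → con 1 :+ (con 2 :* x :+ (con 1 :+ r)) := con 2 :* (con 1 :+ x) :+ r) refl (length r) (length xs) ⟩
      2 * length (x ∷ xs) + length r         ∎
      where
      open ≤-Reasoning
      open +-*-Solver

    reverse-≢[] : ∀ {xs : List A} → xs ≢ [] → reverse xs ≢ []
    reverse-≢[] xs≢[] eq = xs≢[] (reverse-injective eq)

    -- `m` counts the finished blocks. Each has consumed `length q` symbols of `f` and produced
    -- twice as many, hence the two offsets.
    weave-follows : ∀ {f q} m p r xs → p ≢ [] → p ʳ++ r ≡ q →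
                    Follows f (m * length q + length r) xs →
                    Follows (interleave q f) (m * (length q + length q) + length r) (weave p r xs)
    weave-follows m p        r []       p≢[] eq []         = []
    weave-follows m []       r (x ∷ xs) p≢[] eq fxs        with () ← p≢[] refl
    weave-follows {f} {q} m (b ∷ []) r (x ∷ xs) _ refl (x≡ ∷ fxs) =
      trans x≡ (sym (interleave-copy q f m (length r) ≤-refl)) ∷
      -- The block is complete and `q` is now `b ∷ r`: it is emitted, and block `suc m` starts with
      -- a full zipper.
      Follows-++ (subst₂ (Follows (interleave q f)) (+-suc (m * (length q + length q)) (length r)) (window-interleave-insert q f m)
                   (Follows-window (interleave q f) (m * (length q + length q) + length q) (length q)))
        (subst (λ s → Follows (interleave q f) s (weave (reverse q) [] xs))
          (solve 2 (λ m r → (con 1 :+ m) :* (con 1 :+ r :+ (con 1 :+ r)) :+ con 0 := con 1 :+ (m :* (con 1 :+ r :+ (con 1 :+ r)) :+ r) :+ (con 1 :+ r)) refl m (length r))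
          (weave-follows (suc m) (reverse q) [] xs (reverse-≢[] {q} λ ()) (reverse-involutive q)
            (subst (λ s → Follows f s xs) (solve 2 (λ m r → con 1 :+ (m :* (con 1 :+ r) :+ r) := (con 1 :+ m) :* (con 1 :+ r) :+ con 0) refl m (length r)) fxs)))
      where open +-*-Solver
    weave-follows {f} {q} m (b ∷ p@(_ ∷ _)) r (x ∷ xs) _ eq (x≡ ∷ fxs) =
      trans x≡ (sym (interleave-copy q f m (length r) r<a)) ∷
      subst (λ s → Follows (interleave q f) s (weave p (b ∷ r) xs)) (+-suc (m * (length q + length q)) (length r))
        (weave-follows m p (b ∷ r) xs (λ ()) eq (subst (λ s → Follows f s xs) (sym (+-suc (m * length q) (length r))) fxs))
      where
      r<a : length r < length q
      r<a = begin-strict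
        length r                         <⟨ s≤s (m≤n+m (length r) _) ⟩
        length (b ∷ p) + length r        ≡⟨ length-ʳ++ (b ∷ p) ⟨
        length ((b ∷ p) ʳ++ r)           ≡⟨ cong length eq ⟩
        length q                         ∎
        where open ≤-Reasoning

  -- Windows that are UESs, and how insertions lengthen them

  module _ {d n : ℕ} where

    window-infix : ∀ (f : ℕ → Fin (suc d)) s s′ l l′ → s ≤ s′ → s′ + l′ ≤ s + l →
                   IsUES (suc d) n (window f s′ l′) → IsUES (suc d) n (window f s l)
    window-infix f s s′ l l′ s≤s′ end ues
      with x , refl ← m≤n⇒∃[o]m+o≡n s≤s′
      with y , s+x+l′+y ← m≤n⇒∃[o]m+o≡n end
      rewrite +-cancelˡ-≡ s l (x + (l′ + y)) (trans (sym s+x+l′+y) (trans (+-assoc (s + x) l′ y) (+-assoc s x (l′ + y))))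
      | window-++ f s x (l′ + y) | window-++ f (s + x) l′ y
      = IsUES-infix (window f s x) (window f (s + x + l′) y) ues

    module _ (q : List (Fin (suc d))) .{{_ : NonZero (length q)}} where
      private
        a : ℕ
        a = length q
        instance
          a+a≢0 : NonZero (a + a)
          a+a≢0 = m+n≢0 a a
            where
            m+n≢0 : ∀ m n .{{_ : NonZero m}} → NonZero (m + n)
            m+n≢0 (suc m) n = _

      aligned : ℕ → ℕ
      aligned s = suc (s / (a + a))

      aligned-≥ : ∀ s → s ≤ aligned s * (a + a)
      aligned-≥ s = begin
        s                                      ≡⟨ m≡m%n+[m/n]*n s (a + a) ⟩
        s % (a + a) + s / (a + a) * (a + a)    ≤⟨ +-monoˡ-≤ _ (m%n≤n s (a + a)) ⟩
        aligned s * (a + a)                    ∎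
        where open ≤-Reasoning

      aligned-≤ : ∀ s → aligned s * (a + a) ≤ s + (a + a)
      aligned-≤ s = begin
        a + a + s / (a + a) * (a + a)          ≡⟨ +-comm (a + a) _ ⟩
        s / (a + a) * (a + a) + (a + a)        ≤⟨ +-monoˡ-≤ (a + a) (m/n*n≤m s (a + a)) ⟩
        s + (a + a)                            ∎
        where open ≤-Reasoning

      -- The next block boundary is at most `2 * a` symbols away, and the block of `2 * a` symbols
      -- beginning there ends with `q`.
      interleave-inserted : IsUES (suc d) n q → ∀ f s → IsUES (suc d) n (window (interleave q f) s (4 * a))
      interleave-inserted ues f s =
        window-infix (interleave q f) s (m * (a + a) + a) (4 * a) a (≤-trans (aligned-≥ s) (m≤m+n _ a)) (begin
          m * (a + a) + a + a          ≡⟨ +-assoc (m * (a + a)) a a ⟩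
          m * (a + a) + (a + a)        ≤⟨ +-monoˡ-≤ (a + a) (aligned-≤ s) ⟩
          s + (a + a) + (a + a)        ≡⟨ solve 2 (λ s a → s :+ (a :+ a) :+ (a :+ a) := s :+ con 4 :* a) refl s a ⟩
          s + 4 * a                    ∎)
          (subst (IsUES (suc d) n) (sym (window-interleave-insert q f m)) ues)
        where
        open ≤-Reasoning
        open +-*-Solver
        m : ℕ
        m = aligned s

      -- After each block of `f` the walk runs through `q` and comes back to the same edge, so it
      -- enters the next block as if nothing had been inserted.
      interleave-walk : IsLoop q → ∀ f {k} (G : Graph k) ν t m e {v} →
                        v ∈ walk G ν (window f (m * a) (t * a)) e →
                        v ∈ walk G ν (window (interleave q f) (m * (a + a)) (t * (a + a))) e
      interleave-walk isLoop f G ν zero    m e v∈ = v∈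
      interleave-walk isLoop f G ν (suc t) m e {v} v∈
        rewrite window-++ f (m * a) a (t * a)
              | window-++ (interleave q f) (m * (a + a)) (a + a) (t * (a + a))
              | window-interleave q f m
              | +-comm (m * a) a
              | +-comm (m * (a + a)) (a + a)
              | ++-assoc (window f (m * a) a) q (window (interleave q f) (suc m * (a + a)) (t * (a + a)))
        with walk-++⁻ G ν (window f (m * a) a) _ e v∈
      ... | inj₁ v∈b = walk-++⁺ˡ G ν (window f (m * a) a) _ e v∈b
      ... | inj₂ v∈w = walk-++⁺ʳ G ν (window f (m * a) a) _ e (walk-++⁺ʳ G ν q _ _
        (subst (λ e → v ∈ walk G ν _ e) (sym (isLoop G ν _)) (interleave-walk isLoop f G ν t (suc m) _ v∈w)))

      -- Rounding `l` up to whole blocks of `f` adds at most `a`, insertion doubles the result, and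
      -- moving the start to a block boundary costs at most `2 * a` more.
      interleave-UES : IsLoop q → ∀ f l → (∀ s → IsUES (suc d) n (window f s l)) →
                       ∀ s → IsUES (suc d) n (window (interleave q f) s (2 * l + 4 * a))
      interleave-UES isLoop f l ues s =
        window-infix (interleave q f) s (m * (a + a)) (2 * l + 4 * a) (t * (a + a)) (aligned-≥ s) (begin
          m * (a + a) + t * (a + a)          ≤⟨ +-mono-≤ (aligned-≤ s) (begin
              t * (a + a)                    ≡⟨ *-distribˡ-+ t a a ⟩
              t * a + t * a                  ≤⟨ +-mono-≤ t*a≤ t*a≤ ⟩
              l + a + (l + a)                ∎) ⟩
          s + (a + a) + (l + a + (l + a))    ≡⟨ solve 3 (λ s a l → s :+ (a :+ a) :+ (l :+ a :+ (l :+ a)) := s :+ (con 2 :* l :+ con 4 :* a)) refl s a l ⟩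
          s + (2 * l + 4 * a)                ∎)
          (λ k k≤n G conn reg ν e v → interleave-walk isLoop f G ν t m e
            (window-infix f (m * a) (m * a) (t * a) l ≤-refl (+-monoʳ-≤ (m * a) l≤t*a) (ues (m * a)) k k≤n G conn reg ν e v))
        where
        open ≤-Reasoning
        open +-*-Solver
        m t : ℕ
        m = aligned s
        t = suc (l / a)
        t*a≤ : t * a ≤ l + a
        t*a≤ = begin
          a + l / a * a   ≡⟨ +-comm a _ ⟩
          l / a * a + a   ≤⟨ +-monoˡ-≤ a (m/n*n≤m l a) ⟩
          l + a           ∎
        l≤t*a : l ≤ t * a
        l≤t*a = begin
          l                     ≡⟨ m≡m%n+[m/n]*n l a ⟩
          l % a + l / a * a     ≤⟨ +-monoˡ-≤ _ (m%n≤n l a) ⟩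
          t * a                 ∎

    -- A level turns the window length `l` into at most `2 * l + 4 * A`. In terms of `l + 4 * A`
    -- this is a doubling, whence the power of two.
    expand-UES : ∀ (q : ℕ → List (Fin (suc d))) → (∀ j → NonZero (length (q j))) → (∀ j → IsLoop (q j)) →
                 ∀ k A → (∀ j → j < k → length (q j) ≤ A) →
                 ∀ f l → (∀ s → IsUES (suc d) n (window f s l)) →
                 ∀ s → IsUES (suc d) n (window (expand q k f) s (2 ^ k * (l + 4 * A)))
    expand-UES q q≢0 isLoop zero    A short f l ues s =
      window-infix f s s _ l ≤-refl (+-monoʳ-≤ s (≤-trans (m≤m+n l (4 * A)) (m≤m+n _ 0))) (ues s)
    expand-UES q q≢0 isLoop (suc k) A short f l ues s =
      window-infix (expand q (suc k) f) s s _ _ ≤-refl (+-monoʳ-≤ s (begin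
          2 ^ k * (2 * l + 4 * a + 4 * A)   ≤⟨ *-monoʳ-≤ (2 ^ k) (+-monoˡ-≤ (4 * A) (+-monoʳ-≤ (2 * l) (*-monoʳ-≤ 4 (short k ≤-refl)))) ⟩
          2 ^ k * (2 * l + 4 * A + 4 * A)   ≡⟨ solve 3 (λ x l A → x :* (con 2 :* l :+ con 4 :* A :+ con 4 :* A) := con 2 :* x :* (l :+ con 4 :* A)) refl (2 ^ k) l A ⟩
          2 ^ suc k * (l + 4 * A)           ∎))
        (expand-UES q q≢0 isLoop k A (λ j j<k → short j (m≤n⇒m≤1+n j<k)) (interleave (q k) f) (2 * l + 4 * a)
          (interleave-UES (q k) {{q≢0 k}} (isLoop k) f l ues) s)
      where
      open ≤-Reasoning
      open +-*-Solver
      a : ℕ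
      a = length (q k)

-- Estimates with roots

module Growth where
  open import Defs
  open import Data.Fin.Base using (Fin; zero; suc)
  open import Data.List.Base using (List; []; _∷_; _++_; map; length)
  open import Data.List.Properties using (length-++; length-reverse; length-map)
  open import Data.Nat.Base using (ℕ; zero; suc; _+_; _*_; _^_; _≤_; _<_; z≤n; s≤s; _⊔_; NonZero; >-nonZero; >-nonZero⁻¹)
  open import Data.Nat.Properties
  open import Data.Nat.Solver using (module +-*-Solver)
  open import Data.Product.Base using (∃-syntax; _×_; _,_; proj₁)
  open import Data.Sum.Base using (inj₁; inj₂)
  open import Function.Base using (_∘_)
  open import Relation.Binary.PropositionalEquality
  open Walks
  open Streams

  n<2^n : ∀ n → n < 2 ^ n
  n<2^n zero    = s≤s z≤n
  n<2^n (suc n) = begin-strict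
    suc n            <⟨ +-mono-≤-< (m^n>0 2 n) (n<2^n n) ⟩
    2 ^ n + 2 ^ n    ≡⟨ cong (_+_ (2 ^ n)) (+-identityʳ (2 ^ n)) ⟨
    2 ^ suc n        ∎
    where open ≤-Reasoning

  ^-distribʳ-* : ∀ m n o → (m * n) ^ o ≡ m ^ o * n ^ o
  ^-distribʳ-* m n zero    = refl
  ^-distribʳ-* m n (suc o) = trans (cong (m * n *_) (^-distribʳ-* m n o))
    (solve 4 (λ m n x y → m :* n :* (x :* y) := m :* x :* (n :* y)) refl m n (m ^ o) (n ^ o))
    where open +-*-Solver

  -- a ≤ K w^(1/y)
  record RootBound (y w a K : ℕ) : Set where
    constructor rootBound
    field
      bound : a ^ y ≤ K ^ y * w

  module _ {y w : ℕ} where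
    open ≤-Reasoning

    RootBound-⊔ : ∀ {a b K} → RootBound y w a K → RootBound y w b K → RootBound y w (a ⊔ b) K
    RootBound-⊔ {a} {b} aK bK with ⊔-sel a b
    ... | inj₁ eq rewrite eq = aK
    ... | inj₂ eq rewrite eq = bK

    RootBound-mono : ∀ {a b K L} → a ≤ b → K ≤ L → RootBound y w b K → RootBound y w a L
    RootBound-mono {a} {b} {K} {L} a≤b K≤L (rootBound bK) = rootBound (begin
      a ^ y        ≤⟨ ^-monoˡ-≤ y a≤b ⟩
      b ^ y        ≤⟨ bK ⟩
      K ^ y * w    ≤⟨ *-monoˡ-≤ w (^-monoˡ-≤ y K≤L) ⟩
      L ^ y * w    ∎)

    RootBound-* : ∀ {a K} c → RootBound y w a K → RootBound y w (c * a) (c * K)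
    RootBound-* {a} {K} c (rootBound aK) = rootBound (begin
      (c * a) ^ y          ≡⟨ ^-distribʳ-* c a y ⟩
      c ^ y * a ^ y        ≤⟨ *-monoʳ-≤ (c ^ y) aK ⟩
      c ^ y * (K ^ y * w)  ≡⟨ *-assoc (c ^ y) (K ^ y) w ⟨
      c ^ y * K ^ y * w    ≡⟨ cong (_* w) (^-distribʳ-* c K y) ⟨
      (c * K) ^ y * w      ∎)

    -- Powers of a sum are awkward, so the sum is replaced by twice its larger summand.
    RootBound-+ : ∀ {a b K} → RootBound y w a K → RootBound y w b K → RootBound y w (a + b) (2 * K)
    RootBound-+ {a} {b} {K} aK bK = RootBound-mono (begin
      a + b                  ≤⟨ +-mono-≤ (m≤m⊔n a b) (m≤n⊔m a b) ⟩
      a ⊔ b + (a ⊔ b)        ≡⟨ cong ((a ⊔ b) +_) (+-identityʳ (a ⊔ b)) ⟨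
      2 * (a ⊔ b)            ∎) ≤-refl (RootBound-* 2 (RootBound-⊔ aK bK))

  maxUpTo : (ℕ → ℕ) → ℕ → ℕ
  maxUpTo f zero    = f zero
  maxUpTo f (suc k) = f (suc k) ⊔ maxUpTo f k

  ≤-maxUpTo : ∀ f {j k} → j ≤ k → f j ≤ maxUpTo f k
  ≤-maxUpTo f {j} {zero}  z≤n = ≤-refl
  ≤-maxUpTo f {j} {suc k} j≤1+k with m≤n⇒m<n∨m≡n j≤1+k
  ... | inj₁ (s≤s j≤k) = ≤-trans (≤-maxUpTo f j≤k) (m≤n⊔m (f (suc k)) _)
  ... | inj₂ refl      = m≤m⊔n (f (suc k)) _

  RootBound-maxUpTo : ∀ {y w K} f k → (∀ j → j ≤ k → RootBound y w (f j) K) → RootBound y w (maxUpTo f k) K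
  RootBound-maxUpTo f zero    fK = fK zero z≤n
  RootBound-maxUpTo f (suc k) fK = RootBound-⊔ (fK (suc k) ≤-refl)
    (RootBound-maxUpTo f k (λ j j≤k → fK j (m≤n⇒m≤1+n j≤k)))

  -- The sequence and its cover time

  module Construction {d : ℕ} (l : ℕ) .{{_ : NonZero l}} (u : ℕ → List (Fin (suc d))) where

    -- The ratio of consecutive sizes; the factor 2 lost at each level is its l-th root.
    B : ℕ
    B = 2 ^ l

    instance
      B≢0 : NonZero B
      B≢0 = m^n≢0 2 l

    2≤B : 2 ≤ B
    2≤B = begin
      2 ^ 1    ≤⟨ ^-monoʳ-≤ 2 (>-nonZero⁻¹ l) ⟩
      2 ^ l    ∎
      where open ≤-Reasoning

    B^-mono : ∀ {j k} → j ≤ k → B ^ j ≤ B ^ k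
    B^-mono = ^-monoʳ-≤ B

    n<B^n : ∀ n → n < B ^ n
    n<B^n n = <-≤-trans (n<2^n n) (^-monoˡ-≤ n 2≤B)

    loopWord : ℕ → List (Fin (suc d))
    loopWord j = roundTrip (u (B ^ j)) (B ^ j)

    length-zeroPairs : ∀ n → length (zeroPairs {d} n) ≡ 2 * n
    length-zeroPairs zero    = refl
    length-zeroPairs (suc n) = trans (cong (2 +_) (length-zeroPairs n)) (sym (*-suc 2 n))

    length-loopWord : ∀ j → length (loopWord j) ≡ 2 * length (u (B ^ j)) + (2 + 2 * B ^ j)
    length-loopWord j = begin
      length (loopWord j)
        ≡⟨ length-++ (u (B ^ j)) ⟩
      L + suc (length (inverse (u (B ^ j)) ++ zero ∷ zeroPairs (B ^ j)))
        ≡⟨ cong (λ x → L + suc x) (length-++ (inverse (u (B ^ j)))) ⟩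
      L + suc (length (inverse (u (B ^ j))) + suc (length (zeroPairs {d} (B ^ j))))
        ≡⟨ cong₂ (λ x y → L + suc (x + suc y)) (trans (length-reverse (map neg (u (B ^ j)))) (length-map neg (u (B ^ j)))) (length-zeroPairs (B ^ j)) ⟩
      L + suc (L + suc (2 * B ^ j))
        ≡⟨ solve 2 (λ L b → L :+ (con 1 :+ (L :+ (con 1 :+ con 2 :* b))) := con 2 :* L :+ (con 2 :+ con 2 :* b)) refl L (B ^ j) ⟩
      2 * L + (2 + 2 * B ^ j)
        ∎
      where
      open ≡-Reasoning
      open +-*-Solver
      L : ℕ
      L = length (u (B ^ j))

    B^j≤length-loopWord : ∀ j → B ^ j ≤ length (loopWord j)
    B^j≤length-loopWord j = begin
      B ^ j                                      ≤⟨ m≤m+n _ _ ⟩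
      2 * B ^ j                                  ≤⟨ m≤n+m _ (2 * length (u (B ^ j)) + 2) ⟩
      2 * length (u (B ^ j)) + 2 + 2 * B ^ j     ≡⟨ +-assoc (2 * length (u (B ^ j))) 2 _ ⟩
      2 * length (u (B ^ j)) + (2 + 2 * B ^ j)   ≡⟨ length-loopWord j ⟨
      length (loopWord j)                        ∎
      where open ≤-Reasoning

    loopWord≢0 : ∀ j → NonZero (length (loopWord j))
    loopWord≢0 j = >-nonZero (<-≤-trans (m^n>0 B j) (B^j≤length-loopWord j))

    approximant : ℕ → ℕ → Fin (suc d)
    approximant k = expand loopWord k (λ _ → zero)

    -- A diagonal choice: position `i` is settled at level `i`, because the loop words from that
    -- level on have at least `B ^ i`, hence more than `i`, symbols.
    τ : ℕ → Fin (suc d)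
    τ i = approximant i i

    τ≗approximant : ∀ {n} k → n ≤ B ^ k → τ ≗[ n ] approximant k
    τ≗approximant {n} k n≤B^k i i<n = begin
      approximant i i          ≡⟨ expand-stable loopWord _ i k (λ j i≤j → long {j = j} (<-≤-trans (n<B^n i) (B^-mono i≤j))) i ≤-refl ⟨
      approximant (k + i) i    ≡⟨ cong (λ j → approximant j i) (+-comm k i) ⟩
      approximant (i + k) i    ≡⟨ expand-stable loopWord _ k i (λ j k≤j → long {j = j} (≤-trans n≤B^k (B^-mono k≤j))) i i<n ⟩
      approximant k i          ∎
      where
      open ≡-Reasoning
      long : ∀ {m j} → m ≤ B ^ j → m ≤ length (loopWord j)
      long {j = j} m≤B^j = ≤-trans m≤B^j (B^j≤length-loopWord j)

    -- Only powers of `B` serve as sizes; the second bound says that this costs a factor of at most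
    -- `B`.
    scale : ∀ n → 1 ≤ n → ∃[ k ] n ≤ B ^ k × B ^ k ≤ B * n
    scale (suc zero)      _ = 0 , ≤-refl , ≤-trans (>-nonZero⁻¹ B) (m≤m*n B 1)
    scale (suc n@(suc _)) _ with scale n (s≤s z≤n)
    ... | k , n≤B^k , B^k≤B*n with m≤n⇒m<n∨m≡n n≤B^k
    ...   | inj₁ n<B^k = k , n<B^k , ≤-trans B^k≤B*n (*-monoʳ-≤ B (n≤1+n n))
    ...   | inj₂ n≡B^k = suc k , (begin
      suc n        ≤⟨ +-monoˡ-≤ n (s≤s z≤n) ⟩
      n + n        ≡⟨ cong (n +_) (+-identityʳ n) ⟨
      2 * n        ≤⟨ *-mono-≤ 2≤B n≤B^k ⟩
      B ^ suc k    ∎) , *-monoʳ-≤ B (≤-trans (≤-reflexive (sym n≡B^k)) (n≤1+n n))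
      where open ≤-Reasoning

    -- The lengths of the given UESs need not increase with the size, so the last loop word need not
    -- be the longest.
    longest : ℕ → ℕ
    longest = maxUpTo (length ∘ loopWord)

    -- The first `4 * longest k` is room for a complete `loopWord k` right after its insertion; the
    -- second is the summand `4 * A` of `expand-UES`. The value at zero is a default.
    coverTime : ℕ → ℕ
    coverTime zero      = 0
    coverTime n@(suc _) = 2 ^ k * (4 * longest k + 4 * longest k)
      where
      k : ℕ
      k = proj₁ (scale n (s≤s z≤n))

    τ-isSUES : (∀ n → 1 ≤ n → IsUES (suc d) n (u n)) → IsSUES (suc d) τ coverTime
    τ-isSUES ues n@(suc _) _ start
      with k , n≤B^k , _ ← scale n (s≤s z≤n)
      -- With `start + p` further levels, where `p` is the length of the window, the approximant
      -- agrees with `τ` on the whole window; those above level `k` disappear into `f`.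
      with f , eq ← expand-+ loopWord (λ _ → zero) (suc k) (start + 2 ^ k * (4 * longest k + 4 * longest k))
      = subst (IsUES (suc d) n) (sym (applyUpTo-cong p λ i i<p →
          trans (τ≗approximant (start + p + suc k) big (start + i) (+-monoʳ-< start i<p)) (cong (λ g → g (start + i)) eq)))
          (expand-UES loopWord loopWord≢0 (λ j → roundTrip-isLoop (u (B ^ j)) (B ^ j)) k (longest k)
            (λ j j<k → ≤-maxUpTo (length ∘ loopWord) (<⇒≤ j<k)) _ _
            (λ s → window-infix (interleave (loopWord k) f) s s _ _ ≤-refl
              (+-monoʳ-≤ s (*-monoʳ-≤ 4 (≤-maxUpTo (length ∘ loopWord) {k} ≤-refl)))
              (interleave-inserted (loopWord k) {{loopWord≢0 k}} loopWord-UES f s))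
            start)
      where
      p : ℕ
      p = 2 ^ k * (4 * longest k + 4 * longest k)

      big : start + p ≤ B ^ (start + p + suc k)
      big = ≤-trans (m≤m+n _ (suc k)) (<⇒≤ (n<B^n (start + p + suc k)))

      loopWord-UES : IsUES (suc d) n (loopWord k)
      loopWord-UES = IsUES-infix [] {u (B ^ k)} _ (IsUES-anti n≤B^k (ues (B ^ k) (≤-trans (s≤s z≤n) n≤B^k)))

    -- With u n ≤ K n^e for e = x/y ≥ 1 this is coverTime n = O(n^(e (1 + 1/l))); the
    -- constant depends on e only through the factor B^(x (1 + l)).
    coverTime-bound : ∀ K x y → y ≤ x → (∀ n → 1 ≤ n → length (u n) ^ y ≤ K ^ y * n ^ x) →
                      ∀ n → 1 ≤ n → coverTime n ^ (y * l) ≤ (32 * (K + 2)) ^ (y * l) * (B * n) ^ (x * suc l)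
    coverTime-bound K x y y≤x bound n@(suc _) _ with k , _ , B^k≤B*n ← scale n (s≤s z≤n) = begin
      (2 ^ k * (4 * A + 4 * A)) ^ (y * l)
        ≡⟨ cong (λ a → (2 ^ k * a) ^ (y * l)) (solve 1 (λ A → con 4 :* A :+ con 4 :* A := con 8 :* A) refl A) ⟩
      (2 ^ k * (8 * A)) ^ (y * l)
        ≡⟨ ^-distribʳ-* (2 ^ k) (8 * A) (y * l) ⟩
      (2 ^ k) ^ (y * l) * (8 * A) ^ (y * l)
        ≡⟨ cong₂ _*_ eq (sym (^-*-assoc (8 * A) y l)) ⟩
      N ^ y * ((8 * A) ^ y) ^ l
        -- Here the exponent x/y being at least 1 is used: it raises `N ^ y` to `N ^ x`.
        ≤⟨ *-mono-≤ (^-monoʳ-≤ N y≤x) (^-monoˡ-≤ l (RootBound.bound bound-8A)) ⟩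
      N ^ x * ((32 * (K + 2)) ^ y * N ^ x) ^ l
        ≡⟨ cong (N ^ x *_) (^-distribʳ-* ((32 * (K + 2)) ^ y) (N ^ x) l) ⟩
      N ^ x * (((32 * (K + 2)) ^ y) ^ l * (N ^ x) ^ l)
        ≡⟨ cong₂ (λ a b → N ^ x * (a * b)) (^-*-assoc (32 * (K + 2)) y l) (^-*-assoc N x l) ⟩
      N ^ x * ((32 * (K + 2)) ^ (y * l) * N ^ (x * l))
        ≡⟨ solve 3 (λ a b c → a :* (b :* c) := b :* (a :* c)) refl (N ^ x) ((32 * (K + 2)) ^ (y * l)) (N ^ (x * l)) ⟩
      (32 * (K + 2)) ^ (y * l) * (N ^ x * N ^ (x * l))
        ≡⟨ cong ((32 * (K + 2)) ^ (y * l) *_) (^-distribˡ-+-* N x (x * l)) ⟨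
      (32 * (K + 2)) ^ (y * l) * N ^ (x + x * l)
        ≡⟨ cong (λ e → (32 * (K + 2)) ^ (y * l) * N ^ e) (*-suc x l) ⟨
      (32 * (K + 2)) ^ (y * l) * N ^ (x * suc l)
        ≤⟨ *-monoʳ-≤ ((32 * (K + 2)) ^ (y * l)) (^-monoˡ-≤ (x * suc l) B^k≤B*n) ⟩
      (32 * (K + 2)) ^ (y * l) * (B * n) ^ (x * suc l)
        ∎
      where
      open ≤-Reasoning
      open +-*-Solver
      A N : ℕ
      A = longest k
      N = B ^ k

      instance
        N≢0 : NonZero N
        N≢0 = m^n≢0 B k

      eq : (2 ^ k) ^ (y * l) ≡ N ^ y
      eq = begin-equality
        (2 ^ k) ^ (y * l)    ≡⟨ ^-*-assoc 2 k (y * l) ⟩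
        2 ^ (k * (y * l))    ≡⟨ cong (2 ^_) (solve 3 (λ k y l → k :* (y :* l) := l :* (k :* y)) refl k y l) ⟩
        2 ^ (l * (k * y))    ≡⟨ ^-*-assoc 2 l (k * y) ⟨
        B ^ (k * y)          ≡⟨ ^-*-assoc B k y ⟨
        N ^ y                ∎

      bound-u : ∀ j → j ≤ k → RootBound y (N ^ x) (length (u (B ^ j))) (K + 2)
      bound-u j j≤k = RootBound-mono ≤-refl (m≤m+n K 2) (rootBound (≤-trans (bound (B ^ j) (m^n>0 B j))
        (*-monoʳ-≤ (K ^ y) (^-monoˡ-≤ x (B^-mono j≤k)))))

      bound-B : ∀ j → j ≤ k → RootBound y (N ^ x) (1 + B ^ j) (K + 2)
      bound-B j j≤k = rootBound (begin
        (1 + B ^ j) ^ y          ≤⟨ ^-monoˡ-≤ y (+-mono-≤ (m^n>0 B k) (B^-mono j≤k)) ⟩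
        (N + N) ^ y              ≡⟨ cong (λ z → (N + z) ^ y) (+-identityʳ N) ⟨
        (2 * N) ^ y              ≡⟨ ^-distribʳ-* 2 N y ⟩
        2 ^ y * N ^ y            ≤⟨ *-mono-≤ (^-monoˡ-≤ y (m≤n+m 2 K)) (^-monoʳ-≤ N y≤x) ⟩
        (K + 2) ^ y * N ^ x      ∎)

      -- A loop word has length `2 * length (u (B ^ j)) + 2 * (1 + B ^ j)`. Both summands carry a
      -- factor 2, `RootBound-+` gives another one, and 8 comes from `coverTime`. The constant
      -- `K + 2` covers `K` for the UES and the 2 in `1 + B ^ j ≤ 2 * N`.
      bound-8A : RootBound y (N ^ x) (8 * A) (32 * (K + 2))
      bound-8A = subst (RootBound y (N ^ x) (8 * A)) (solve 1 (λ K → con 8 :* (con 2 :* (con 2 :* K)) := con 32 :* K) refl (K + 2))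
        (RootBound-* 8 (RootBound-maxUpTo (length ∘ loopWord) k λ j j≤k →
          subst (λ a → RootBound y (N ^ x) a (2 * (2 * (K + 2))))
            (sym (trans (length-loopWord j) (cong (2 * length (u (B ^ j)) +_) (sym (*-distribˡ-+ 2 1 (B ^ j))))))
            (RootBound-+ (RootBound-* 2 (bound-u j j≤k)) (RootBound-* 2 (bound-B j j≤k)))))

-- Uniform bounds for all rational exponents above a real one

module Rates where
  open import Defs
  open import Data.Fin.Base using (Fin)
  open import Data.Integer.Base as ℤ using (+_; -[1+_])
  import Data.Integer.Properties as ℤ
  open import Data.List.Base using (List; length)
  import Data.Nat.Base as ℕ
  open import Data.Nat.Base using (ℕ; zero; suc; _*_; _^_; _≤_; _<_; z≤n; s≤s; NonZero)
  open import Data.Nat.Properties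
  open import Data.Nat.Solver using (module +-*-Solver)
  open import Data.Product.Base using (∃-syntax; _,_)
  open import Data.Rational.Unnormalised.Base as ℚᵘ using (ℚᵘ; mkℚᵘ; 1ℚᵘ; ↥_; ↧ₙ_; *≤*; *<*)
  import Data.Rational.Unnormalised.Properties as ℚᵘ
  open import Relation.Binary.PropositionalEquality
  open import Relation.Nullary using (yes; no)
  open Growth

  BoundedByPower-* : ∀ a K n q r → a ^ (↧ₙ q * ↧ₙ r) ≤ K ^ (↧ₙ q * ↧ₙ r) * n ^ (ℤ.∣ ↥ q ∣ * ℤ.∣ ↥ r ∣) →
                     BoundedByPower a K n (q ℚᵘ.* r)
  BoundedByPower-* a K n q@record{} r@record{} bound =
    subst (λ e → a ^ (↧ₙ q * ↧ₙ r) ≤ K ^ (↧ₙ q * ↧ₙ r) * n ^ e) (sym (ℤ.abs-* (↥ q) (↥ r))) bound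

  BoundedByPower-1 : ∀ a K n q → BoundedByPower a K n (q ℚᵘ.* 1ℚᵘ) → a ^ ↧ₙ q ≤ K ^ ↧ₙ q * n ^ ℤ.∣ ↥ q ∣
  BoundedByPower-1 a K n q@record{} bound =
    subst₂ (λ y x → a ^ y ≤ K ^ y * n ^ x) (*-identityʳ (↧ₙ q)) (trans (ℤ.abs-* (↥ q) (+ 1)) (*-identityʳ ℤ.∣ ↥ q ∣)) bound

  -- The zeroth approximation is within 1 of `c` and at most the absolute value of its numerator;
  -- adding 2 instead of 1 makes the inequality strict.
  ceiling : ℝ → ℕ
  ceiling c = 2 ℕ.+ ℤ.∣ ↥ (approx c 0) ∣

  <ceiling : ∀ c → c <ᴿ mkℚᵘ (+ ceiling c) 0
  <ceiling c = 0 , (begin-strict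
    approx c 0 ℚᵘ.+ (1/1+ 0)               ≤⟨ ℚᵘ.+-monoˡ-≤ (1/1+ 0) (≤∣↥∣ (approx c 0)) ⟩
    mkℚᵘ (+ N) 0 ℚᵘ.+ (1/1+ 0)             <⟨ +1<+2 N ⟩
    mkℚᵘ (+ ceiling c) 0                   ∎)
    where
    open ℚᵘ.≤-Reasoning
    open +-*-Solver
    N : ℕ
    N = ℤ.∣ ↥ (approx c 0) ∣

    +1<+2 : ∀ m → mkℚᵘ (+ m) 0 ℚᵘ.+ (1/1+ 0) ℚᵘ.< mkℚᵘ (+ (2 ℕ.+ m)) 0
    +1<+2 zero    = *<* (ℤ.+<+ (s≤s (s≤s z≤n)))
    +1<+2 (suc m) = *<* (ℤ.+<+ (≤-reflexive
      (solve 1 (λ m → con 1 :+ (con 1 :+ m :* con 1 :+ con 1) :* con 1 := (con 3 :+ m) :* con 1) refl m)))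

    ≤∣↥∣ : ∀ p → p ℚᵘ.≤ mkℚᵘ (+ ℤ.∣ ↥ p ∣) 0
    ≤∣↥∣ (mkℚᵘ (+ x) y)    = *≤* (ℤ.*-monoˡ-≤-nonNeg (+ x) (ℤ.+≤+ (s≤s z≤n)))
    ≤∣↥∣ (mkℚᵘ -[1+ x ] y) = *≤* ℤ.-≤+

  1<⇒↧≤↥ : ∀ {q} → 1ℚᵘ ℚᵘ.< q → ↧ₙ q ≤ ℤ.∣ ↥ q ∣
  1<⇒↧≤↥ {mkℚᵘ (+ x) y} (*<* lt)
    with ℤ.+<+ y<x ← subst₂ ℤ._<_ (ℤ.*-identityˡ (+ suc y)) (ℤ.*-identityʳ (+ x)) lt = <⇒≤ y<x
  1<⇒↧≤↥ {mkℚᵘ -[1+ x ] y} (*<* ())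

  coverTime-growth : ∀ {d} c l .{{_ : NonZero l}} (u : ℕ → List (Fin (suc d))) → 1ℚᵘ ≤ᴿ c →
                     (λ n → length (u n)) ∈O[n^ c · 1ℚᵘ ] →
                     Construction.coverTime l u ∈O[n^ c · 1ℚᵘ ℚᵘ.+ (+ 1 ℚᵘ./ l) ]
  coverTime-growth c l@(suc l-1) u 1≤c (K , length-u) = L , bounded
    where
    open Construction l u
    open ≤-Reasoning
    open +-*-Solver
    r : ℚᵘ
    r = 1ℚᵘ ℚᵘ.+ (+ 1 ℚᵘ./ l)

    r↧ : ↧ₙ r ≡ l
    r↧ = *-identityˡ l

    r↥ : ℤ.∣ ↥ r ∣ ≡ suc l
    r↥ = solve 1 (λ m → con 1 :+ (m :+ con 0 :+ con 1) := con 2 :+ m) refl l-1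

    Q L : ℕ
    Q = ceiling c
    -- For x/y up to `Q` the factor `B ^ (x * suc l)` has exponent at most `Q * 2 * (y * l)`, since
    -- `suc l` is at most `l + l`. As a `(y * l)`-th root it thus contributes `B ^ (Q * 2)`.
    L = 32 * (K ℕ.+ 2) * B ^ (Q * 2)

    ↧≤↥ : ∀ q → c <ᴿ q → ↧ₙ q ≤ ℤ.∣ ↥ q ∣
    ↧≤↥ q (k , c<q) = 1<⇒↧≤↥ (ℚᵘ.≤-<-trans (1≤c k) c<q)

    -- Only exponents x/y up to Q give a uniform constant; a larger one yields a
    -- weaker bound than Q itself.
    small : ∀ n → 1 ≤ n → ∀ q → c <ᴿ q → ℤ.∣ ↥ q ∣ ≤ Q * ↧ₙ q →
            coverTime n ^ (↧ₙ q * l) ≤ L ^ (↧ₙ q * l) * n ^ (ℤ.∣ ↥ q ∣ * suc l)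
    small n 1≤n q c<q x≤Q*y = begin
      coverTime n ^ (y * l)
        ≤⟨ coverTime-bound K x y (↧≤↥ q c<q) (λ n 1≤n → BoundedByPower-1 (length (u n)) K n q (length-u n 1≤n q c<q)) n 1≤n ⟩
      K′ ^ (y * l) * (B * n) ^ (x * suc l)
        ≡⟨ cong (K′ ^ (y * l) *_) (^-distribʳ-* B n (x * suc l)) ⟩
      K′ ^ (y * l) * (B ^ (x * suc l) * n ^ (x * suc l))
        ≡⟨ *-assoc (K′ ^ (y * l)) _ _ ⟨
      K′ ^ (y * l) * B ^ (x * suc l) * n ^ (x * suc l)
        ≤⟨ *-monoˡ-≤ (n ^ (x * suc l)) (*-monoʳ-≤ (K′ ^ (y * l)) (^-monoʳ-≤ B exponent)) ⟩
      K′ ^ (y * l) * B ^ (Q * 2 * (y * l)) * n ^ (x * suc l)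
        ≡⟨ cong (λ b → K′ ^ (y * l) * b * n ^ (x * suc l)) (^-*-assoc B (Q * 2) (y * l)) ⟨
      K′ ^ (y * l) * (B ^ (Q * 2)) ^ (y * l) * n ^ (x * suc l)
        ≡⟨ cong (_* n ^ (x * suc l)) (^-distribʳ-* K′ (B ^ (Q * 2)) (y * l)) ⟨
      L ^ (y * l) * n ^ (x * suc l)
        ∎
      where
      x y K′ : ℕ
      x = ℤ.∣ ↥ q ∣
      y = ↧ₙ q
      K′ = 32 * (K ℕ.+ 2)
      exponent : x * suc l ≤ Q * 2 * (y * l)
      exponent = begin
        x * suc l              ≤⟨ *-mono-≤ x≤Q*y (s≤s (m≤n+m l l-1)) ⟩
        Q * y * (l ℕ.+ l)      ≡⟨ solve 3 (λ Q y l → Q :* y :* (l :+ l) := Q :* con 2 :* (y :* l)) refl Q y l ⟩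
        Q * 2 * (y * l)        ∎

    bounded′ : ∀ n → 1 ≤ n → ∀ q → c <ᴿ q →
               coverTime n ^ (↧ₙ q * l) ≤ L ^ (↧ₙ q * l) * n ^ (ℤ.∣ ↥ q ∣ * suc l)
    bounded′ n@(suc _) 1≤n q c<q with ℤ.∣ ↥ q ∣ ≤? Q * ↧ₙ q
    ... | yes x≤Q*y = small n 1≤n q c<q x≤Q*y
    ... | no  x≰Q*y = begin
      coverTime n ^ (y * l)                      ≡⟨ cong (coverTime n ^_) (*-comm y l) ⟩
      coverTime n ^ (l * y)                      ≡⟨ ^-*-assoc (coverTime n) l y ⟨
      (coverTime n ^ l) ^ y                      ≤⟨ ^-monoˡ-≤ y at-Q ⟩
      (L ^ l * n ^ (Q * suc l)) ^ y              ≡⟨ ^-distribʳ-* (L ^ l) (n ^ (Q * suc l)) y ⟩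
      (L ^ l) ^ y * (n ^ (Q * suc l)) ^ y        ≡⟨ cong₂ _*_ (trans (^-*-assoc L l y) (cong (L ^_) (*-comm l y))) (^-*-assoc n (Q * suc l) y) ⟩
      L ^ (y * l) * n ^ (Q * suc l * y)          ≤⟨ *-monoʳ-≤ (L ^ (y * l)) (^-monoʳ-≤ n exponent) ⟩
      L ^ (y * l) * n ^ (ℤ.∣ ↥ q ∣ * suc l)      ∎
      where
      y : ℕ
      y = ↧ₙ q
      at-Q : coverTime n ^ l ≤ L ^ l * n ^ (Q * suc l)
      at-Q = subst (λ e → coverTime n ^ e ≤ L ^ e * n ^ (Q * suc l)) (*-identityˡ l)
        (small n 1≤n (mkℚᵘ (+ Q) 0) (<ceiling c) (≤-reflexive (sym (*-identityʳ Q))))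
      exponent : Q * suc l * y ≤ ℤ.∣ ↥ q ∣ * suc l
      exponent = begin
        Q * suc l * y          ≡⟨ solve 3 (λ a b c → a :* b :* c := a :* c :* b) refl Q (suc l) y ⟩
        Q * y * suc l          ≤⟨ *-monoˡ-≤ (suc l) (≰⇒≥ x≰Q*y) ⟩
        ℤ.∣ ↥ q ∣ * suc l      ∎

    bounded : ∀ n → 1 ≤ n → ∀ q → c <ᴿ q → BoundedByPower (coverTime n) L n (q ℚᵘ.* r)
    bounded n 1≤n q c<q = BoundedByPower-* (coverTime n) L n q r
      (subst₂ (λ e f → coverTime n ^ (↧ₙ q * e) ≤ L ^ (↧ₙ q * e) * n ^ (ℤ.∣ ↥ q ∣ * f)) (sym r↧) (sym r↥)
        (bounded′ n 1≤n q c<q))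

  -- An integer exponent above `c` is enough for running times.
  length-polynomial : ∀ {c f} → f ∈O[n^ c · 1ℚᵘ ] → ∃[ K ] ∀ n → 1 ≤ n → f n ≤ K * n ^ ceiling c
  length-polynomial {c} {f} (K , bound) = K , λ n 1≤n →
    subst₂ (λ a b → a ≤ b * n ^ ceiling c) (*-identityʳ (f n)) (*-identityʳ K)
      (BoundedByPower-1 (f n) K n (mkℚᵘ (+ ceiling c) 0) (bound n 1≤n (mkℚᵘ (+ ceiling c) 0) (<ceiling c)))

-- Composing stack programs with time bounds

module Machines where
  open import Defs
  open import Data.Fin.Base using (Fin; zero; suc)
  open import Data.List.Base using (List; []; _∷_; length; drop; head; _ʳ++_)
  open import Data.Maybe.Base using (Maybe; maybe′)
  open import Data.Nat.Base using (ℕ; zero; suc; _+_; _*_; _≤_; s≤s)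
  open import Data.Nat.Properties
  open import Data.Nat.Solver using (module +-*-Solver)
  open import Data.Product.Base using (∃-syntax; _×_; _,_)
  open import Data.Vec.Base as Vec using (Vec; lookup; _[_]%=_)
  open import Relation.Binary.PropositionalEquality

  module _ {A : Set} where

    -- Upper bounds in place of exact times, so that estimates can be made locally and then
    -- composed.
    record ⟨_,_⟩↓[_]_ {k} (C : Command A k) (σ : Stacks A k) (T : ℕ) (σ′ : Stacks A k) : Set where
      constructor halts
      field
        {time} : ℕ
        halt   : ⟨ C , σ ⟩⇓[ time ] σ′
        time≤  : time ≤ T

    module _ {k : ℕ} where

      infixr 4 _⨾↓_

      -- Lets `do` blocks denote sequences of commands.
      _>>_ : Command A k → Command A k → Command A k
      _>>_ = _⨾_

      exactly : ∀ {C : Command A k} {σ t σ′} → ⟨ C , σ ⟩⇓[ t ] σ′ → ⟨ C , σ ⟩↓[ t ] σ′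
      exactly h = halts h ≤-refl

      within : ∀ {C : Command A k} {σ T T′ σ′} → T ≤ T′ → ⟨ C , σ ⟩↓[ T ] σ′ → ⟨ C , σ ⟩↓[ T′ ] σ′
      within T≤T′ (halts h t≤T) = halts h (≤-trans t≤T T≤T′)

      halting : ∀ {C : Command A k} {σ T T′} (P : Stacks A k → Set) → T ≤ T′ → ∃[ σ′ ] (⟨ C , σ ⟩↓[ T ] σ′) × P σ′ →
                ∃[ t ] ∃[ σ′ ] (⟨ C , σ ⟩⇓[ t ] σ′) × P σ′ × t ≤ T′
      halting P T≤T′ (σ′ , halts h t≤T , Pσ′) = _ , σ′ , h , Pσ′ , ≤-trans t≤T T≤T′

      ending : ∀ {C : Command A k} {σ T σ′ σ″} → σ′ ≡ σ″ → ⟨ C , σ ⟩↓[ T ] σ′ → ⟨ C , σ ⟩↓[ T ] σ″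
      ending refl h = h

      _⨾↓_ : ∀ {C D : Command A k} {σ σ′ σ″ T T′} →
             ⟨ C , σ ⟩↓[ T ] σ′ → ⟨ D , σ′ ⟩↓[ T′ ] σ″ → ⟨ C ⨾ D , σ ⟩↓[ T + T′ ] σ″
      halts h t≤T ⨾↓ halts h′ t≤T′ = halts (h ⨾ h′) (+-mono-≤ t≤T t≤T′)

      loop↓ : ∀ {i} {C : Command A k} {σ σ′ σ″ T T′ a as} → lookup σ i ≡ a ∷ as →
              ⟨ C , σ ⟩↓[ T ] σ′ → ⟨ while i C , σ′ ⟩↓[ T′ ] σ″ → ⟨ while i C , σ ⟩↓[ suc (T + T′) ] σ″
      loop↓ eq (halts h t≤T) (halts h′ t≤T′) = halts (loop eq h h′) (s≤s (+-mono-≤ t≤T t≤T′))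

      switch↓ : ∀ {i} {B : Maybe A → Command A k} {σ T σ′} →
                ⟨ B (head (lookup σ i)) , σ ⟩↓[ T ] σ′ → ⟨ switch i B , σ ⟩↓[ suc T ] σ′
      switch↓ (halts h t≤T) = halts (switch h) (s≤s t≤T)

      onTop : Fin k → (A → Command A k) → Command A k
      onTop i f = switch i (maybe′ (λ a → pop i >> f a) skip)

      transfer : Fin k → Fin k → Command A k
      transfer i j = onTop i (push j)

      pour : Fin k → Fin k → Command A k
      pour i j = while i (transfer i j)

      clear : Fin k → Command A k
      clear i = while i (pop i)

      pushes : ℕ → Fin k → A → Command A k
      pushes zero    i a = skip
      pushes (suc n) i a = push i a >> pushes n i a

      onTop↓ : ∀ {i f a as} {σ σ′ : Stacks A k} {T} → lookup σ i ≡ a ∷ as →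
               ⟨ f a , σ [ i ]%= drop 1 ⟩↓[ T ] σ′ → ⟨ onTop i f , σ ⟩↓[ 2 + T ] σ′
      onTop↓ {i} {f} {σ = σ} {σ′} eq (halts h t≤T) = halts
        (switch (subst (λ xs → ⟨ maybe′ (λ a → pop i ⨾ f a) skip (head xs) , σ ⟩⇓[ _ ] σ′) (sym eq) (pop ⨾ h)))
        (s≤s (s≤s t≤T))

      -- Here st xs ys is the state with xs on stack i and ys on stack j.
      pour↓ : ∀ {i j} (st : List A → List A → Stacks A k) →
              (∀ xs ys → lookup (st xs ys) i ≡ xs) →
              (∀ x xs ys → st (x ∷ xs) ys [ i ]%= drop 1 ≡ st xs ys) →
              (∀ x xs ys → st xs ys [ j ]%= (x ∷_) ≡ st xs (x ∷ ys)) →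
              ∀ xs ys → ⟨ pour i j , st xs ys ⟩↓[ length xs * 4 + 1 ] st [] (xs ʳ++ ys)
      pour↓ st top popped pushed []       ys = exactly (done (top [] ys))
      pour↓ st top popped pushed (x ∷ xs) ys = loop↓ (top (x ∷ xs) ys)
        (onTop↓ (top (x ∷ xs) ys) (subst (λ σ → ⟨ _ , σ ⟩↓[ 1 ] _) (sym (popped x xs ys)) (ending (pushed x xs ys) (exactly push))))
        (pour↓ st top popped pushed xs (x ∷ ys))

      clear↓ : ∀ {i} (st : List A → Stacks A k) →
               (∀ xs → lookup (st xs) i ≡ xs) →
               (∀ x xs → st (x ∷ xs) [ i ]%= drop 1 ≡ st xs) →
               ∀ xs → ⟨ clear i , st xs ⟩↓[ length xs * 2 + 1 ] st []
      clear↓ st top popped []       = exactly (done (top []))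
      clear↓ st top popped (x ∷ xs) = loop↓ (top (x ∷ xs)) (ending (popped x xs) (exactly pop)) (clear↓ st top popped xs)

    -- Embeds a machine into one with an additional stack that it never touches; the machine for `u`
    -- becomes a subroutine in this way.
    lift : ∀ {k} → Command A k → Command A (suc k)
    lift skip         = skip
    lift (push i a)   = push (suc i) a
    lift (pop i)      = pop (suc i)
    lift (C ⨾ D)      = lift C ⨾ lift D
    lift (switch i B) = switch (suc i) (λ a → lift (B a))
    lift (while i C)  = while (suc i) (lift C)

    lift⇓ : ∀ {k} {C : Command A k} {σ t σ′} xs → ⟨ C , σ ⟩⇓[ t ] σ′ → ⟨ lift C , xs Vec.∷ σ ⟩⇓[ t ] (xs Vec.∷ σ′)
    lift⇓ xs skip           = skip
    lift⇓ xs push           = push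
    lift⇓ xs pop            = pop
    lift⇓ xs (h ⨾ h′)       = lift⇓ xs h ⨾ lift⇓ xs h′
    lift⇓ xs (switch h)     = switch (lift⇓ xs h)
    lift⇓ xs (done eq)      = done eq
    lift⇓ xs (loop eq h h′) = loop eq (lift⇓ xs h) (lift⇓ xs h′)

    shift : ∀ m {k} → Command A k → Command A (m + k)
    shift zero    C = C
    shift (suc m) C = lift (shift m C)

    shift↓ : ∀ {m k} {C : Command A k} {σ T σ′} (ρ : Stacks A m) →
             ⟨ C , σ ⟩↓[ T ] σ′ → ⟨ shift m C , ρ Vec.++ σ ⟩↓[ T ] (ρ Vec.++ σ′)
    shift↓ Vec.[]       h = h
    shift↓ (xs Vec.∷ ρ) h with halts h′ t≤T ← shift↓ ρ h = halts (lift⇓ xs h′) t≤T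

    total : ∀ {k} → Stacks A k → ℕ
    total Vec.[]       = 0
    total (xs Vec.∷ σ) = length xs + total σ

    total-push : ∀ {k} (σ : Stacks A k) i a → total (σ [ i ]%= (a ∷_)) ≡ suc (total σ)
    total-push (xs Vec.∷ σ) zero    a = refl
    total-push (xs Vec.∷ σ) (suc i) a = trans (cong (length xs +_) (total-push σ i a)) (+-suc (length xs) (total σ))

    total-pop : ∀ {k} (σ : Stacks A k) i → total (σ [ i ]%= drop 1) ≤ total σ
    total-pop ([]       Vec.∷ σ) zero    = ≤-refl
    total-pop ((x ∷ xs) Vec.∷ σ) zero    = n≤1+n _
    total-pop (xs Vec.∷ σ)       (suc i) = +-monoʳ-≤ (length xs) (total-pop σ i)

    -- A step pushes at most one symbol. This limits the garbage left by a subroutine, and so the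
    -- cost of clearing it.
    total-⇓ : ∀ {k} {C : Command A k} {σ t σ′} → ⟨ C , σ ⟩⇓[ t ] σ′ → total σ′ ≤ total σ + t
    total-⇓ {σ = σ} skip               = m≤m+n (total σ) 1
    total-⇓ {σ = σ} (push {i = i} {a}) = ≤-reflexive (trans (total-push σ i a) (+-comm 1 (total σ)))
    total-⇓ {σ = σ} (pop {i = i})      = ≤-trans (total-pop σ i) (m≤m+n (total σ) 1)
    total-⇓ {σ = σ} (_⨾_ {t = t} {t′} h h′) = ≤-trans (total-⇓ h′)
      (≤-trans (+-monoˡ-≤ t′ (total-⇓ h)) (≤-reflexive (+-assoc (total σ) t t′)))
    total-⇓ {σ = σ} (switch h)         = ≤-trans (total-⇓ h) (+-monoʳ-≤ (total σ) (n≤1+n _))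
    total-⇓ {σ = σ} (done eq)          = m≤m+n (total σ) 1
    total-⇓ {σ = σ} (loop {t = t} {t′} eq h h′) = ≤-trans (total-⇓ h′)
      (≤-trans (+-monoˡ-≤ t′ (total-⇓ h))
        (≤-trans (≤-reflexive (+-assoc (total σ) t t′)) (+-monoʳ-≤ (total σ) (n≤1+n _))))

    clearAll : ∀ k → Command A k
    clearAll zero    = skip
    clearAll (suc k) = clear zero >> lift (clearAll k)

    clearAll↓ : ∀ {k} (σ : Stacks A k) → ⟨ clearAll k , σ ⟩↓[ total σ * 2 + suc k ] Vec.replicate k []
    clearAll↓ Vec.[]                = exactly skip
    clearAll↓ {suc k} (xs Vec.∷ σ) = within (≤-reflexive
        (solve 3 (λ x y k → x :* con 2 :+ con 1 :+ (y :* con 2 :+ k) := (x :+ y) :* con 2 :+ (con 1 :+ k)) refl (length xs) (total σ) (suc k)))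
      (clear↓ (Vec._∷ σ) (λ _ → refl) (λ _ _ → refl) xs ⨾↓ shift↓ ([] Vec.∷ Vec.[]) (clearAll↓ σ))
      where open +-*-Solver

-- A program for the prefixes of the sequence

module Programs where
  open import Defs
  open import Data.Empty using (⊥-elim)
  open import Data.Fin.Base using (Fin; zero; suc)
  open import Data.List.Base using (List; []; _∷_; _++_; length; drop; map; replicate; reverse; _ʳ++_; applyUpTo)
  open import Data.List.Properties
  open import Data.Maybe.Base using (maybe′)
  open import Data.Nat.Base using (ℕ; zero; suc; _+_; _*_; _∸_; _^_; _≤_; _<_; z≤n; s≤s; NonZero; ≢-nonZero⁻¹)
  open import Data.Nat.Properties
  open import Data.Nat.Solver using (module +-*-Solver)
  open import Data.Product.Base using (∃-syntax; _×_; _,_)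
  open import Data.Vec.Base as Vec using (Vec)
  open import Relation.Binary.PropositionalEquality
  open Walks
  open Streams
  open Growth
  open Machines

  module _ {A : Set} where

    drop-suc : ∀ n (xs : List A) → drop n (drop 1 xs) ≡ drop (suc n) xs
    drop-suc zero    []       = refl
    drop-suc (suc n) []       = refl
    drop-suc n       (x ∷ xs) = refl

    replicate-ʳ++ : ∀ n (x : A) ys → replicate n x ʳ++ ys ≡ replicate n x ++ ys
    replicate-ʳ++ zero    x ys = refl
    replicate-ʳ++ (suc n) x ys = trans (replicate-ʳ++ n x (x ∷ ys)) (shuffle n)
      where
      shuffle : ∀ n → replicate n x ++ x ∷ ys ≡ x ∷ replicate n x ++ ys
      shuffle zero    = refl
      shuffle (suc n) = cong (x ∷_) (shuffle n)

    replicate-ʳ++-[] : ∀ n (x : A) → replicate n x ʳ++ [] ≡ replicate n x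
    replicate-ʳ++-[] n x = trans (replicate-ʳ++ n x []) (++-identityʳ _)

    replicate-+-ʳ++ : ∀ m n (x : A) ys → replicate (m + n) x ʳ++ ys ≡ replicate n x ʳ++ replicate m x ʳ++ ys
    replicate-+-ʳ++ zero    n x ys = refl
    replicate-+-ʳ++ (suc m) n x ys = replicate-+-ʳ++ m n x (x ∷ ys)

    drop-replicate : ∀ m n (x : A) → drop m (replicate n x) ≡ replicate (n ∸ m) x
    drop-replicate zero    n       x = refl
    drop-replicate (suc m) zero    x = refl
    drop-replicate (suc m) (suc n) x = drop-replicate m n x

  module Program {d s k : ℕ} (l : ℕ) .{{_ : NonZero l}} (u : ℕ → List (Fin (suc d)))
                 (C : Command (Symbol (suc d) s) (2 + k)) where

    open Construction l u

    private
      A : Set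
      A = Symbol (suc d) s

    -- `Y: input, then words in reverse; `O: output; `M: the size of the current level
    -- in unary; `R: what the sizes lack to the length of the prefix; `S: loop words;
    -- `P, `Q: the zipper of weave; `X: the current word; `T: the symbols to emit;
    -- `U, `V: input and output of C.
    pattern `Y = zero
    pattern `O = suc `Y
    pattern `M = suc `O
    pattern `R = suc `M
    pattern `S = suc `R
    pattern `P = suc `S
    pattern `Q = suc `P
    pattern `X = suc `Q
    pattern `T = suc `X
    pattern `U = suc `T
    pattern `V = suc `U

    st : (y o m r s p q x t : List A) → Stacks A (2 + k) → Stacks A (11 + k)
    st y o m r s p q x t ρ = y Vec.∷ o Vec.∷ m Vec.∷ r Vec.∷ s Vec.∷ p Vec.∷ q Vec.∷ x Vec.∷ t Vec.∷ ρ

    initialise : Command A (11 + k)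
    initialise = while `Y do
      pop `Y
      push `R mark
      push `X (out zero)
      push `T mark

    initialise↓ : ∀ n {o m r s p q x t ρ} →
      ⟨ initialise , st (replicate n mark) o m r s p q x t ρ ⟩↓[ n * 5 + 1 ]
      st [] o m (replicate n mark ʳ++ r) s p q (replicate n (out zero) ʳ++ x) (replicate n mark ʳ++ t) ρ
    initialise↓ zero    = exactly (done refl)
    initialise↓ (suc n) = loop↓ refl (exactly pop ⨾↓ exactly push ⨾↓ exactly push ⨾↓ exactly push) (initialise↓ n)

    pushes↓ : ∀ n {y o m r s p q x t ρ} →
      ⟨ pushes n `P mark , st y o m r s p q x t ρ ⟩↓[ n + 1 ]
      st y o m r s (replicate n mark ʳ++ p) q x t ρ
    pushes↓ zero    = exactly skip
    pushes↓ (suc n) = exactly push ⨾↓ pushes↓ n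

    -- Reading a unary counter destroys it, so a single pass serves every use of the size: input of
    -- `C`, next size, padding, and the subtraction from the remaining length.
    count : Command A (11 + k)
    count = while `M do
      pop `M
      pop `R
      push `U mark
      pushes B `P mark
      push `S (out zero)
      push `S (out zero)

    count↓ : ∀ n {y o r s p q x t v ρ} →
      ⟨ count , st y o (replicate n mark) r s p q x t (v Vec.∷ ρ) ⟩↓[ n * (7 + B) + 1 ]
      st y o [] (drop n r) (map out (zeroPairs n) ʳ++ s) (replicate (n * B) mark ʳ++ p) q x t ((replicate n mark ʳ++ v) Vec.∷ ρ)
    count↓ zero    = exactly (done refl)
    count↓ (suc n) {y} {o} {r} {s} {p} {q} {x} {t} {v} {ρ} =
      ending (cong₂ (λ r p → st y o [] r (map out (zeroPairs (suc n)) ʳ++ s) p q x t ((replicate (suc n) mark ʳ++ v) Vec.∷ ρ))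
               (drop-suc n r) (sym (replicate-+-ʳ++ B (n * B) mark p)))
        (within (≤-reflexive (solve 2 (λ B x → con 1 :+ (con 1 :+ (con 1 :+ (con 1 :+ (B :+ con 1 :+ con 2)))) :+ (x :+ con 1) := con 7 :+ B :+ x :+ con 1) refl B (n * (7 + B))))
          (loop↓ refl (exactly pop ⨾↓ exactly pop ⨾↓ exactly push ⨾↓ pushes↓ B ⨾↓ exactly push ⨾↓ exactly push) (count↓ n)))
      where open +-*-Solver

    unload : Command A (11 + k)
    unload = while `V (onTop `V λ where
      (out z) → push `S (out (neg z)) >> push `Q (out z)
      mark    → skip
      (aux z) → skip)

    unload↓ : ∀ ts {y o m r s p q x t v ρ} →
      ⟨ unload , st y o m r s p q x t (v Vec.∷ map out ts Vec.∷ ρ) ⟩↓[ length ts * 5 + 1 ]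
      st y o m r (map out (map neg ts) ʳ++ s) p (map out ts ʳ++ q) x t (v Vec.∷ [] Vec.∷ ρ)
    unload↓ []       = exactly (done refl)
    unload↓ (z ∷ ts) = loop↓ refl (onTop↓ refl (exactly push ⨾↓ exactly push)) (unload↓ ts)

    -- With size n in unary on M, replace it by B n and put the loop word of size n
    -- on S, above a separator; R loses n.
    level : Command A (11 + k)
    level = do
      push `S mark
      count
      shift 9 C
      push `S (out zero)
      unload
      push `S (out zero)
      pour `Q `S
      shift 9 (clearAll (2 + k))
      pour `P `M

    map-out-zeroPairs-ʳ++ : ∀ n (s : List A) → map out (zeroPairs n) ʳ++ s ≡ map out (zeroPairs n) ++ s
    map-out-zeroPairs-ʳ++ zero    s = refl
    map-out-zeroPairs-ʳ++ (suc n) s = trans (map-out-zeroPairs-ʳ++ n _) (shuffle n s)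
      where
      shuffle : ∀ n (s : List A) → map out (zeroPairs n) ++ out zero ∷ out zero ∷ s ≡ out zero ∷ out zero ∷ map out (zeroPairs n) ++ s
      shuffle zero    s = refl
      shuffle (suc n) s = cong (λ s → out zero ∷ out zero ∷ s) (shuffle n s)

    -- A stack is filled from the end of the word. The part `ts` passes through an intermediate
    -- stack, so its two reversals cancel; the negated symbols are reversed only once, as `inverse`
    -- demands.
    roundTrip-stack : ∀ ts n (s : List A) →
      (map out ts ʳ++ []) ʳ++ (out zero ∷ (map out (map neg ts) ʳ++ (out zero ∷ (map out (zeroPairs n) ʳ++ s)))) ≡ map out (roundTrip ts n) ++ s
    roundTrip-stack ts n s = begin
      (map out ts ʳ++ []) ʳ++ (out zero ∷ (map out (map neg ts) ʳ++ (out zero ∷ (map out (zeroPairs n) ʳ++ s))))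
        ≡⟨ ʳ++-ʳ++ (map out ts) ⟩
      map out ts ++ out zero ∷ (map out (map neg ts) ʳ++ (out zero ∷ (map out (zeroPairs n) ʳ++ s)))
        ≡⟨ cong (λ z → map out ts ++ out zero ∷ (map out (map neg ts) ʳ++ (out zero ∷ z))) (map-out-zeroPairs-ʳ++ n s) ⟩
      map out ts ++ out zero ∷ (map out (map neg ts) ʳ++ (out zero ∷ (map out (zeroPairs n) ++ s)))
        ≡⟨ cong (λ z → map out ts ++ out zero ∷ z) (ʳ++-defn (map out (map neg ts))) ⟩
      map out ts ++ out zero ∷ (reverse (map out (map neg ts)) ++ (out zero ∷ (map out (zeroPairs n) ++ s)))
        ≡⟨ cong (λ z → map out ts ++ out zero ∷ (z ++ _)) (reverse-map out (map neg ts)) ⟨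
      map out ts ++ out zero ∷ (map out (inverse ts) ++ map out (zero ∷ zeroPairs n) ++ s)
        ≡⟨ cong (λ z → map out ts ++ out zero ∷ z) (++-assoc (map out (inverse ts)) _ s) ⟨
      map out ts ++ out zero ∷ ((map out (inverse ts) ++ map out (zero ∷ zeroPairs n)) ++ s)
        ≡⟨ cong (λ z → map out ts ++ out zero ∷ (z ++ s)) (map-++ out (inverse ts) _) ⟨
      map out ts ++ map out (zero ∷ inverse ts ++ zero ∷ zeroPairs n) ++ s
        ≡⟨ ++-assoc (map out ts) _ s ⟨
      (map out ts ++ map out (zero ∷ inverse ts ++ zero ∷ zeroPairs n)) ++ s
        ≡⟨ cong (_++ s) (map-++ out ts _) ⟨
      map out (roundTrip ts n) ++ s
        ∎
      where open ≡-Reasoning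

    -- T bounds the running time of C.
    levelTime : (ℕ → ℕ) → ℕ → ℕ
    levelTime T n = 1 + (n * (7 + B) + 1 + (T n + (1 + (length (u n) * 5 + 1 + (1 +
      (length (u n) * 4 + 1 + (((n + T n) * 2 + suc (2 + k)) + (n * B * 4 + 1))))))))

    module _ {T : ℕ → ℕ}
             (runs : ∀ n → ∃[ t ] ∃[ σ ] (⟨ C , initial k n ⟩⇓[ t ] σ) × output σ ≡ map out (u n) × t ≤ T n) where

      level↓ : ∀ n {y o r s x t} →
        ⟨ level , st y o (replicate n mark) r s [] [] x t (Vec.replicate (2 + k) []) ⟩↓[ levelTime T n ]
        st y o (replicate (n * B) mark) (drop n r) (map out (roundTrip (u n) n) ++ mark ∷ s) [] [] x t (Vec.replicate (2 + k) [])
      level↓ n {y} {o} {r} {s} {x} {t}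
        with time , (v Vec.∷ w Vec.∷ ρ) , run , eq , time≤ ← runs n =
        exactly push ⨾↓
        ending (cong₂ (λ v p → st y o [] (drop n r) (map out (zeroPairs n) ʳ++ mark ∷ s) p [] x t (v Vec.∷ Vec.replicate (suc k) []))
          (replicate-ʳ++-[] n mark) (replicate-ʳ++-[] (n * B) mark))
          (count↓ n) ⨾↓
        ending (cong (λ w → st y o [] (drop n r) (map out (zeroPairs n) ʳ++ mark ∷ s) (replicate (n * B) mark) [] x t (v Vec.∷ w Vec.∷ ρ)) eq)
          (shift↓ (y Vec.∷ o Vec.∷ [] Vec.∷ drop n r Vec.∷ _ Vec.∷ _ Vec.∷ [] Vec.∷ x Vec.∷ t Vec.∷ Vec.[]) (halts run time≤)) ⨾↓
        exactly push ⨾↓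
        unload↓ (u n) ⨾↓
        exactly push ⨾↓
        within (≤-reflexive (cong (λ a → a * 4 + 1) (trans (length-ʳ++ (map out (u n))) (trans (+-identityʳ _) (length-map out (u n))))))
          (ending (cong (λ s → st y o [] (drop n r) s (replicate (n * B) mark) [] x t (v Vec.∷ [] Vec.∷ ρ)) (roundTrip-stack (u n) n (mark ∷ s)))
            (pour↓ (λ q s → st y o [] (drop n r) s (replicate (n * B) mark) q x t (v Vec.∷ [] Vec.∷ ρ))
              (λ _ _ → refl) (λ _ _ _ → refl) (λ _ _ _ → refl) (map out (u n) ʳ++ []) _)) ⨾↓
        -- `C` must find its stacks empty at the next level.
        within (+-monoˡ-≤ (3 + k) (*-monoˡ-≤ 2 garbage))
          (shift↓ (y Vec.∷ o Vec.∷ [] Vec.∷ drop n r Vec.∷ _ Vec.∷ _ Vec.∷ [] Vec.∷ x Vec.∷ t Vec.∷ Vec.[]) (clearAll↓ (v Vec.∷ [] Vec.∷ ρ))) ⨾↓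
        within (≤-reflexive (cong (λ a → a * 4 + 1) (length-replicate (n * B))))
          (ending (cong (λ m → st y o m (drop n r) loaded [] [] x t (Vec.replicate (2 + k) [])) (replicate-ʳ++-[] (n * B) mark))
            (pour↓ (λ p m → st y o m (drop n r) loaded p [] x t (Vec.replicate (2 + k) []))
              (λ _ _ → refl) (λ _ _ _ → refl) (λ _ _ _ → refl) (replicate (n * B) mark) []))
        where
        loaded : List A
        loaded = map out (roundTrip (u n) n) ++ mark ∷ s

        total-empty : ∀ j → total {A = A} (Vec.replicate j []) ≡ 0
        total-empty zero    = refl
        total-empty (suc j) = total-empty j

        garbage : length v + total ρ ≤ n + T n
        garbage = begin
          length v + total ρ                     ≤⟨ +-monoʳ-≤ (length v) (m≤n+m (total ρ) (length w)) ⟩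
          total (v Vec.∷ w Vec.∷ ρ)              ≤⟨ total-⇓ run ⟩
          total (initial k n) + time             ≤⟨ +-mono-≤ (≤-reflexive (trans (cong₂ _+_ (length-replicate n) (total-empty (suc k))) (+-identityʳ n))) time≤ ⟩
          n + T n                                ∎
          where open ≤-Reasoning

    -- The largest level lies on top, so the words are popped in the order in which `expand` inserts
    -- them.
    store : ℕ → List A
    store zero    = []
    store (suc j) = map out (loopWord j) ++ mark ∷ store j

    levels : Command A (11 + k)
    levels = while `R level

    module _ {T : ℕ → ℕ}
             (runs : ∀ n → ∃[ t ] ∃[ σ ] (⟨ C , initial k n ⟩⇓[ t ] σ) × output σ ≡ map out (u n) × t ≤ T n)
             {N L : ℕ} (levelTime≤L : ∀ n → n ≤ B * N → levelTime T n ≤ L) where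
      open ≤-Reasoning
      open +-*-Solver

      -- The sizes below `B ^ j` add up to at most `B ^ j`, so `N ≤ r + B ^ j` is an invariant, and
      -- an empty `R` shows `N ≤ B ^ j` without any comparison of numbers. A level after the first
      -- runs only if the preceding size is below `N`; so the sizes handed to `C` are at most
      -- `B * N`, and the final one has one more factor `B`. The successor in the bound covers
      -- `N = 0`. Each level lowers `r`, and `f` bounds their number.
      levels↓ : ∀ f r j → r ≤ f → r ≤ N → N ≤ r + B ^ j → (1 ≤ r → B ^ j ≤ B * N) → B ^ j ≤ suc (B * (B * N)) →
        ∃[ i ] N ≤ B ^ i × B ^ i ≤ suc (B * (B * N)) × (∀ {y o x t} →
          ⟨ levels , st y o (replicate (B ^ j) mark) (replicate r mark) (store j) [] [] x t (Vec.replicate (2 + k) []) ⟩↓[ f * suc L + 1 ]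
          st y o (replicate (B ^ i) mark) [] (store i) [] [] x t (Vec.replicate (2 + k) []))
      levels↓ f zero j _ _ N≤ _ B^j≤ = j , N≤ , B^j≤ , within (m≤n+m 1 (f * suc L)) (exactly (done refl))
      levels↓ (suc f) r@(suc r-1) j (s≤s r-1≤f) r≤N N≤ small _
        with i , N≤B^i , B^i≤ , rest ← levels↓ f (r ∸ B ^ j) (suc j)
          (≤-trans (∸-monoʳ-≤ r (m^n>0 B j)) r-1≤f)
          (≤-trans (m∸n≤m r (B ^ j)) r≤N)
          (begin
            N                              ≤⟨ N≤ ⟩
            r + B ^ j                      ≤⟨ +-monoˡ-≤ (B ^ j) (m≤n+m∸n r (B ^ j)) ⟩
            B ^ j + (r ∸ B ^ j) + B ^ j    ≡⟨ solve 2 (λ b r → b :+ r :+ b := r :+ con 2 :* b) refl (B ^ j) (r ∸ B ^ j) ⟩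
            r ∸ B ^ j + 2 * B ^ j          ≤⟨ +-monoʳ-≤ (r ∸ B ^ j) (*-monoˡ-≤ (B ^ j) 2≤B) ⟩
            r ∸ B ^ j + B ^ suc j          ∎)
          (λ 0<r∸ → *-monoʳ-≤ B (≤-trans (<⇒≤ (m∸n≢0⇒n<m (m<n⇒n≢0 0<r∸))) r≤N))
          (m≤n⇒m≤1+n (*-monoʳ-≤ B (small (s≤s z≤n))))
        = i , N≤B^i , B^i≤ , λ {y} {o} {x} {t} → within (≤-reflexive (sym (cong suc (+-assoc L (f * suc L) 1))))
          (loop↓ refl
            (within (levelTime≤L (B ^ j) (small (s≤s z≤n)))
              (ending (cong₂ (λ m r → st y o m r (store (suc j)) [] [] x t (Vec.replicate (2 + k) []))
                        (cong (λ n → replicate n mark) (*-comm (B ^ j) B)) (drop-replicate (B ^ j) r mark))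
                (level↓ runs (B ^ j))))
            rest)

    -- At this point popping `Q` yields the loop word in its proper order, so one pass emits it and
    -- also restores the reversed copy on `P`.
    replay : Command A (11 + k)
    replay = while `Q (onTop `Q λ a → push `P a >> push `Y a)

    replay↓ : ∀ q {y o m r s p x t ρ} →
      ⟨ replay , st y o m r s p q x t ρ ⟩↓[ length q * 5 + 1 ] st (q ʳ++ y) o m r s (q ʳ++ p) [] x t ρ
    replay↓ []      = exactly (done refl)
    replay↓ (a ∷ q) = loop↓ refl (onTop↓ refl (exactly push ⨾↓ exactly push)) (replay↓ q)

    spread : Command A (11 + k)
    spread = while `X do
      transfer `X `Y
      transfer `P `Q
      switch `P (maybe′ (λ _ → skip) replay)

    -- A run of replay is paid for by the symbols which were moved to Q before it.
    spread↓ : ∀ p q xs {y o m r s t ρ} → p ≢ [] → ∃[ p′ ] ∃[ q′ ]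
      length p′ + length q′ ≡ length p + length q ×
      ⟨ spread , st y o m r s (map out p) (map out q) (map out xs) t ρ ⟩↓[ length xs * 14 + (length q * 5 + 1) ]
      st (map out (weave p q xs) ʳ++ y) o m r s p′ q′ [] t ρ
    spread↓ p q [] p≢[] = map out p , map out q , cong₂ _+_ (length-map out p) (length-map out q) ,
      within (m≤n+m 1 (length q * 5)) (exactly (done refl))
    spread↓ [] q (z ∷ xs) p≢[] = ⊥-elim (p≢[] refl)
    spread↓ (b ∷ []) q (z ∷ xs) {y} {o} {m} {r} {s} {t} {ρ} p≢[]
      with p′ , q′ , len , rest ← spread↓ ((b ∷ q) ʳ++ []) [] xs {map out (b ∷ q) ʳ++ out z ∷ y} {o} {m} {r} {s} {t} {ρ}
             (λ eq → 1+n≢0 {length q} (trans (sym (trans (length-ʳ++ (b ∷ q)) (+-identityʳ _))) (cong length eq)))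
      = p′ , q′ , trans len (trans (+-identityʳ _) (trans (length-ʳ++ (b ∷ q)) (+-identityʳ _))) ,
        ending (cong (λ y → st y o m r s p′ q′ [] t ρ) (trans (sym (++-ʳ++ (map out (b ∷ q)))) (cong (_ʳ++ (out z ∷ y)) (sym (map-++ out (b ∷ q) _)))))
          (within (≤-reflexive (trans (cong (λ a → suc (7 + (a * 5 + 1) + (length xs * 14 + 1))) (length-map out (b ∷ q)))
              (solve 2 (λ x q → con 1 :+ (con 7 :+ ((con 1 :+ q) :* con 5 :+ con 1) :+ (x :* con 14 :+ con 1)) := (con 1 :+ x) :* con 14 :+ (q :* con 5 :+ con 1)) refl (length xs) (length q))))
            (loop↓ refl (onTop↓ refl (exactly push) ⨾↓ onTop↓ refl (exactly push) ⨾↓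
                switch↓ (ending (cong (λ p → st (map out (b ∷ q) ʳ++ out z ∷ y) o m r s p [] (map out xs) t ρ) (sym (map-ʳ++ out (b ∷ q)))) (replay↓ (map out (b ∷ q)))))
              rest))
      where open +-*-Solver
    spread↓ (b ∷ c ∷ p) q (z ∷ xs) p≢[]
      with p′ , q′ , len , rest ← spread↓ (c ∷ p) (b ∷ q) xs (λ ())
      = p′ , q′ , trans len (+-suc _ (length q)) ,
        within (≤-reflexive (solve 2 (λ x q → con 1 :+ (con 8 :+ (x :* con 14 :+ ((con 1 :+ q) :* con 5 :+ con 1))) := (con 1 :+ x) :* con 14 :+ (q :* con 5 :+ con 1)) refl (length xs) (length q)))
          (loop↓ refl (onTop↓ refl (exactly push) ⨾↓ onTop↓ refl (exactly push) ⨾↓ switch↓ (exactly skip)) rest)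
      where open +-*-Solver

    insert : Command A (11 + k)
    insert = do
      spread
      clear `P
      clear `Q
      pour `Y `X

    -- Per symbol of `w` there are 14 steps of `spread`, and 8 for pouring back two symbols at 4
    -- steps each.
    insert↓ : ∀ q w {o m r s t ρ} → q ≢ [] →
      ⟨ insert , st [] o m r s (map out (reverse q)) [] (map out w) t ρ ⟩↓[ length q * 2 + length w * 22 + 4 ]
      st [] o m r s [] [] (map out (weave (reverse q) [] w)) t ρ
    insert↓ q w {o} {m} {r} {s} {t} {ρ} q≢[]
      with p′ , q′ , len , h ← spread↓ (reverse q) [] w {[]} {o} {m} {r} {s} {t} {ρ} (reverse-≢[] q≢[])
      = within bound (h ⨾↓
          clear↓ (λ p → st _ o m r s p q′ [] t ρ) (λ _ → refl) (λ _ _ → refl) p′ ⨾↓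
          clear↓ (λ q → st _ o m r s [] q [] t ρ) (λ _ → refl) (λ _ _ → refl) q′ ⨾↓
          ending (cong (λ x → st [] o m r s [] [] x t ρ) (trans (ʳ++-ʳ++ W) (++-identityʳ W)))
            (pour↓ (λ y x → st y o m r s [] [] x t ρ) (λ _ _ → refl) (λ _ _ _ → refl) (λ _ _ _ → refl) (W ʳ++ []) []))
      where
      open ≤-Reasoning
      open +-*-Solver
      W : List A
      W = map out (weave (reverse q) [] w)

      W≤ : length (W ʳ++ []) ≤ 2 * length w
      W≤ = begin
        length (W ʳ++ [])                   ≡⟨ length-ʳ++ W ⟩
        length W + 0                        ≡⟨ +-identityʳ _ ⟩
        length W                            ≡⟨ length-map out (weave (reverse q) [] w) ⟩
        length (weave (reverse q) [] w)     ≤⟨ length-weave-≤ (reverse q) [] w ⟩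
        2 * length w + 0                    ≡⟨ +-identityʳ _ ⟩
        2 * length w                        ∎

      bound : length w * 14 + 1 + (length p′ * 2 + 1 + (length q′ * 2 + 1 + (length (W ʳ++ []) * 4 + 1))) ≤ length q * 2 + length w * 22 + 4
      bound = begin
        length w * 14 + 1 + (length p′ * 2 + 1 + (length q′ * 2 + 1 + (length (W ʳ++ []) * 4 + 1)))
          ≤⟨ +-monoʳ-≤ (length w * 14 + 1) (+-monoʳ-≤ (length p′ * 2 + 1) (+-monoʳ-≤ (length q′ * 2 + 1) (+-monoˡ-≤ 1 (*-monoˡ-≤ 4 W≤)))) ⟩
        length w * 14 + 1 + (length p′ * 2 + 1 + (length q′ * 2 + 1 + (2 * length w * 4 + 1)))
          ≡⟨ solve 3 (λ w p q → w :* con 14 :+ con 1 :+ (p :* con 2 :+ con 1 :+ (q :* con 2 :+ con 1 :+ (con 2 :* w :* con 4 :+ con 1))) := (p :+ q) :* con 2 :+ w :* con 22 :+ con 4) refl (length w) (length p′) (length q′) ⟩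
        (length p′ + length q′) * 2 + length w * 22 + 4
          ≡⟨ cong (λ a → a * 2 + length w * 22 + 4) (trans len (trans (+-identityʳ _) (length-reverse q))) ⟩
        length q * 2 + length w * 22 + 4
          ∎

    assemble : Command A (11 + k)
    assemble = while `S (onTop `S λ where
      (out z) → push `P (out z)
      mark    → insert
      (aux z) → skip)

    load↓ : ∀ ws {y o m r s p q x t ρ T σ} →
      ⟨ assemble , st y o m r s (map out ws ʳ++ p) q x t ρ ⟩↓[ T ] σ →
      ⟨ assemble , st y o m r (map out ws ++ s) p q x t ρ ⟩↓[ length ws * 4 + T ] σ
    load↓ []       h = h
    load↓ (z ∷ ws) h = loop↓ refl (onTop↓ refl (exactly push)) (load↓ ws h)

    loopWord≢[] : ∀ j → loopWord j ≢ []
    loopWord≢[] j eq = ≢-nonZero⁻¹ (length (loopWord j)) {{loopWord≢0 j}} (cong length eq)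

    weave-small : ∀ {V} j p (w : List (Fin (suc d))) → 2 ^ suc j * length w ≤ V → 2 ^ j * length (weave p [] w) ≤ V
    weave-small {V} j p w small = begin
      2 ^ j * length (weave p [] w)      ≤⟨ *-monoʳ-≤ (2 ^ j) (length-weave-≤ p [] w) ⟩
      2 ^ j * (2 * length w + 0)         ≡⟨ solve 2 (λ a w → a :* (con 2 :* w :+ con 0) := con 2 :* a :* w) refl (2 ^ j) (length w) ⟩
      2 ^ suc j * length w               ≤⟨ small ⟩
      V                                  ∎
      where
      open ≤-Reasoning
      open +-*-Solver

    -- `V` bounds every intermediate word: each of the `j` insertions still to come at most doubles
    -- the word, so `2 ^ j * length w` never grows. Of the 6 steps per symbol of a loop word, 4 load
    -- it and 2 clear it.
    assemble↓ : ∀ {W V} j f w → Follows f 0 w → (∀ i → i < j → length (loopWord i) ≤ W) → 2 ^ j * length w ≤ V →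
      ∃[ w′ ] Follows (expand loopWord j f) 0 w′ × length w ≤ length w′ × (∀ {o m r t ρ} →
        ⟨ assemble , st [] o m r (store j) [] [] (map out w) t ρ ⟩↓[ j * (W * 6 + V * 22 + 7) + 1 ]
        st [] o m r [] [] [] (map out w′) t ρ)
    assemble↓ zero f w fw short small = w , fw , ≤-refl , exactly (done refl)
    assemble↓ {W} {V} (suc j) f w fw short small
      with w′ , fw′ , len , rest ← assemble↓ {W} {V} j (interleave (loopWord j) f) (weave (reverse (loopWord j)) [] w)
        (weave-follows 0 (reverse (loopWord j)) [] w (reverse-≢[] (loopWord≢[] j)) (reverse-involutive (loopWord j)) fw)
        (λ i i<j → short i (m≤n⇒m≤1+n i<j)) (weave-small j (reverse (loopWord j)) w small)
      = w′ , fw′ , ≤-trans (length-weave-≥ (reverse (loopWord j)) [] w) len , λ {o} {m} {r} {t} {ρ} →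
        within bound (load↓ (loopWord j) (loop↓ refl
          (onTop↓ refl (subst (λ p → ⟨ insert , st [] o m r (store j) p [] (map out w) t ρ ⟩↓[ _ ] st [] o m r (store j) [] [] (map out (weave (reverse (loopWord j)) [] w)) t ρ)
            (map-ʳ++ out (loopWord j)) (insert↓ (loopWord j) w (loopWord≢[] j))))
          rest))
      where
      open ≤-Reasoning
      open +-*-Solver
      bound : length (loopWord j) * 4 + suc (2 + (length (loopWord j) * 2 + length w * 22 + 4) + (j * (W * 6 + V * 22 + 7) + 1)) ≤ suc j * (W * 6 + V * 22 + 7) + 1
      bound = begin
        length (loopWord j) * 4 + suc (2 + (length (loopWord j) * 2 + length w * 22 + 4) + (j * (W * 6 + V * 22 + 7) + 1))
          ≡⟨ solve 3 (λ a w r → a :* con 4 :+ (con 1 :+ (con 2 :+ (a :* con 2 :+ w :* con 22 :+ con 4) :+ (r :+ con 1))) := a :* con 6 :+ w :* con 22 :+ con 7 :+ r :+ con 1) refl (length (loopWord j)) (length w) (j * (W * 6 + V * 22 + 7)) ⟩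
        length (loopWord j) * 6 + length w * 22 + 7 + j * (W * 6 + V * 22 + 7) + 1
          ≤⟨ +-monoˡ-≤ 1 (+-monoˡ-≤ (j * (W * 6 + V * 22 + 7)) (+-monoˡ-≤ 7 (+-mono-≤ (*-monoˡ-≤ 6 (short j ≤-refl)) (*-monoˡ-≤ 22 w≤V)))) ⟩
        suc j * (W * 6 + V * 22 + 7) + 1
          ∎
        where
        w≤V : length w ≤ V
        w≤V = ≤-trans (m≤n*m (length w) (2 ^ suc j) {{m^n≢0 2 (suc j)}}) small

    emit : Command A (11 + k)
    emit = while `T do
      pop `T
      transfer `X `Y

    emit↓ : ∀ xs {ys y o m r s p q ρ} →
      ⟨ emit , st y o m r s p q (xs ++ ys) (replicate (length xs) mark) ρ ⟩↓[ length xs * 5 + 1 ]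
      st (xs ʳ++ y) o m r s p q ys [] ρ
    emit↓ []       = exactly (done refl)
    emit↓ (x ∷ xs) = loop↓ refl (exactly pop ⨾↓ onTop↓ refl (exactly push)) (emit↓ xs)

    main : Command A (11 + k)
    main = do
      initialise
      push `M mark
      levels
      assemble
      emit
      pour `Y `O

    Follows-const : ∀ {X : Set} {x : X} {s} n → Follows (λ _ → x) s (replicate n x)
    Follows-const zero    = []
    Follows-const (suc n) = refl ∷ Follows-const n

    -- An upper bound for the sizes, and for the number, of the levels in use.
    reach : ℕ → ℕ
    reach N = suc (B * (B * N))

    mainTime : (D L W N : ℕ) → ℕ
    mainTime D L W N = N * 5 + 1 + (1 + (N * suc L + 1 + (D * (W * 6 + D * N * 22 + 7) + 1 + (N * 5 + 1 + (N * 4 + 1)))))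

    -- The approximant is known to agree with `τ` only on its first `B ^ j` symbols, and `w` may be
    -- longer than `N`; hence the cut made by `emit`.
    prefix : ∀ {N j w} → N ≤ B ^ j → N ≤ length w → Follows (approximant j) 0 w → ∃[ rest ] w ≡ applyUpTo τ N ++ rest
    prefix {N} {j} {w} N≤B^j N≤w fw with e , N+e≡ ← m≤n⇒∃[o]m+o≡n N≤w = window (approximant j) N e , (begin
      w                                                     ≡⟨ Follows⇒window fw ⟩
      window (approximant j) 0 (length w)                   ≡⟨ cong (window (approximant j) 0) N+e≡ ⟨
      window (approximant j) 0 (N + e)                      ≡⟨ window-++ (approximant j) 0 N e ⟩
      applyUpTo (approximant j) N ++ window (approximant j) N e ≡⟨ cong (_++ window (approximant j) N e) (applyUpTo-cong N (τ≗approximant j N≤B^j)) ⟨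
      applyUpTo τ N ++ window (approximant j) N e           ∎)
      where open ≡-Reasoning

    module _ {T : ℕ → ℕ}
             (runs : ∀ n → ∃[ t ] ∃[ σ ] (⟨ C , initial k n ⟩⇓[ t ] σ) × output σ ≡ map out (u n) × t ≤ T n)
             {N L W : ℕ} (levelTime≤L : ∀ n → n ≤ B * N → levelTime T n ≤ L)
             (length≤W : ∀ i → B ^ i ≤ reach N → length (loopWord i) ≤ W) where

      main↓ : ∃[ σ ] (⟨ main , initial (9 + k) N ⟩↓[ mainTime (reach N) L W N ] σ) × output σ ≡ map out (applyUpTo τ N)
      main↓
        with i , N≤B^i , B^i≤D , levels-h ← levels↓ runs {N} {L} levelTime≤L N N 0 ≤-refl ≤-refl (m≤m+n N 1)
               (λ 1≤N → *-mono-≤ (≤-trans (s≤s z≤n) 2≤B) 1≤N) (s≤s z≤n)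
        with w , fw , len , assemble-h ← assemble↓ {W} {reach N * N} i (λ _ → zero) (replicate N zero) (Follows-const N)
               (λ j j<i → length≤W j (≤-trans (B^-mono (<⇒≤ j<i)) B^i≤D))
               -- The `i` insertions enlarge the initial `N` zeros by a factor of at most `2 ^ i`,
               -- which is at most `B ^ i` and so polynomial in `N`.
               (*-mono-≤ (≤-trans (^-monoˡ-≤ i 2≤B) B^i≤D) (≤-reflexive (length-replicate N)))
        with rest , w≡ ← prefix {j = i} N≤B^i (≤-trans (≤-reflexive (sym (length-replicate N))) len) fw
        = _ ,
          (initialise↓ N ⨾↓
           exactly push ⨾↓
           subst₂ (λ r t → ⟨ levels , st [] [] (mark ∷ []) r [] [] [] X t empty ⟩↓[ N * suc L + 1 ] st [] [] (replicate (B ^ i) mark) [] (store i) [] [] X (replicate N mark) empty)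
             (sym (replicate-ʳ++-[] N mark)) (sym (replicate-ʳ++-[] N mark)) levels-h ⨾↓
           within (+-monoˡ-≤ 1 (*-monoˡ-≤ (W * 6 + reach N * N * 22 + 7) (≤-trans (<⇒≤ (n<B^n i)) B^i≤D)))
             (subst₂ (λ x x′ → ⟨ assemble , st [] [] (replicate (B ^ i) mark) [] (store i) [] [] x (replicate N mark) empty ⟩↓[ i * (W * 6 + reach N * N * 22 + 7) + 1 ]
                                            st [] [] (replicate (B ^ i) mark) [] [] [] [] x′ (replicate N mark) empty)
               (trans (map-replicate out N zero) (sym (replicate-ʳ++-[] N (out zero)))) (trans (cong (map out) w≡) (map-++ out (applyUpTo τ N) rest))
               assemble-h) ⨾↓
           subst (λ n → ⟨ emit , st [] [] (replicate (B ^ i) mark) [] [] [] [] (O ++ map out rest) (replicate n mark) empty ⟩↓[ n * 5 + 1 ]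
                               st (O ʳ++ []) [] (replicate (B ^ i) mark) [] [] [] [] (map out rest) [] empty)
             length-O (emit↓ O) ⨾↓
           within (≤-reflexive (cong (λ n → n * 4 + 1) (trans (length-ʳ++ O) (trans (+-identityʳ _) length-O))))
             (pour↓ (λ y o → st y o (replicate (B ^ i) mark) [] [] [] [] (map out rest) [] empty)
               (λ _ _ → refl) (λ _ _ _ → refl) (λ _ _ _ → refl) (O ʳ++ []) [])) ,
          trans (ʳ++-ʳ++ O) (++-identityʳ O)
        where
        empty : Stacks A (2 + k)
        empty = Vec.replicate (2 + k) []

        X O : List A
        X = replicate N (out zero) ʳ++ []
        O = map out (applyUpTo τ N)

        length-O : length O ≡ N
        length-O = trans (length-map out (applyUpTo τ N)) (length-applyUpTo τ N)

-- Closure properties of polynomially bounded functions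

module Polynomials where
  open import Data.Nat.Base using (ℕ; zero; suc; _+_; _*_; _^_; _≤_)
  open import Data.Nat.Properties
  open import Data.Nat.Solver using (module +-*-Solver)
  open import Data.Product.Base using (∃-syntax; _,_)
  open import Relation.Binary.PropositionalEquality
  open Growth

  -- With a base that is at least 2 a single exponent absorbs coefficients and constants; a sum
  -- costs one more degree.
  record Polynomial (f : ℕ → ℕ) : Set where
    constructor polynomial
    field
      degree : ℕ
      bound  : ∀ n → f n ≤ (2 + n) ^ degree

  open Polynomial public

  private
    2+n^-mono : ∀ n {a b} → a ≤ b → (2 + n) ^ a ≤ (2 + n) ^ b
    2+n^-mono n = ^-monoʳ-≤ (2 + n)

  infixl 6 _+ᵖ_
  infixl 7 _*ᵖ_
  infixl 8 _^ᵖ_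

  abstract
    ≤-polynomial : ∀ {f g} → (∀ n → f n ≤ g n) → Polynomial g → Polynomial f
    ≤-polynomial f≤g (polynomial b bg) = polynomial b λ n → ≤-trans (f≤g n) (bg n)

    idᵖ : Polynomial (λ n → n)
    idᵖ = polynomial 1 λ n → ≤-trans (m≤n+m n 2) (≤-reflexive (sym (*-identityʳ (2 + n))))

    constᵖ : ∀ k → Polynomial (λ _ → k)
    constᵖ k = polynomial k λ n → ≤-trans (<⇒≤ (n<2^n k)) (^-monoˡ-≤ k (m≤m+n 2 n))

    _*ᵖ_ : ∀ {f g} → Polynomial f → Polynomial g → Polynomial (λ n → f n * g n)
    polynomial a bf *ᵖ polynomial b bg = polynomial (a + b) λ n →
      ≤-trans (*-mono-≤ (bf n) (bg n)) (≤-reflexive (sym (^-distribˡ-+-* (2 + n) a b)))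

    _+ᵖ_ : ∀ {f g} → Polynomial f → Polynomial g → Polynomial (λ n → f n + g n)
    _+ᵖ_ {f} {g} (polynomial a bf) (polynomial b bg) = polynomial (suc (a + b)) λ n → begin
      f n + g n                              ≤⟨ +-mono-≤ (≤-trans (bf n) (2+n^-mono n (m≤m+n a b))) (≤-trans (bg n) (2+n^-mono n (m≤n+m b a))) ⟩
      (2 + n) ^ (a + b) + (2 + n) ^ (a + b)  ≡⟨ cong ((2 + n) ^ (a + b) +_) (+-identityʳ _) ⟨
      2 * (2 + n) ^ (a + b)                  ≤⟨ *-monoˡ-≤ ((2 + n) ^ (a + b)) (m≤m+n 2 n) ⟩
      (2 + n) ^ suc (a + b)                  ∎
      where open ≤-Reasoning

    _^ᵖ_ : ∀ {f} → Polynomial f → ∀ k → Polynomial (λ n → f n ^ k)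
    _^ᵖ_ {f} (polynomial a bf) k = polynomial (a * k) λ n →
      ≤-trans (^-monoˡ-≤ k (bf n)) (≤-reflexive (^-*-assoc (2 + n) a k))

  polynomial-≤ : ∀ {f} → Polynomial f → ∃[ a ] ∃[ b ] ∀ n → f n ≤ a * n ^ b + a
  polynomial-≤ {f} (polynomial b bf) = 3 ^ b , b , λ n → ≤-trans (bf n) (expanded n)
    where
    -- For positive `n` one has `2 + n ≤ 3 * n`; the additive `3 ^ b` takes care of zero.
    expanded : ∀ n → (2 + n) ^ b ≤ 3 ^ b * n ^ b + 3 ^ b
    expanded zero      = ≤-trans (^-monoˡ-≤ b (n≤1+n 2)) (m≤n+m (3 ^ b) _)
    expanded n@(suc m) = begin
      (2 + n) ^ b                ≤⟨ ^-monoˡ-≤ b (begin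
        3 + m                    ≤⟨ m≤m+n (3 + m) (m + m) ⟩
        3 + m + (m + m)          ≡⟨ solve 1 (λ m → con 3 :+ m :+ (m :+ m) := con 3 :* (con 1 :+ m)) refl m ⟩
        3 * n                    ∎) ⟩
      (3 * n) ^ b                ≡⟨ ^-distribʳ-* 3 n b ⟩
      3 ^ b * n ^ b              ≤⟨ m≤m+n _ (3 ^ b) ⟩
      3 ^ b * n ^ b + 3 ^ b      ∎
      where
      open ≤-Reasoning
      open +-*-Solver

-- The program runs in polynomial time

module RunningTimes where
  open import Defs
  open import Data.Rational.Unnormalised.Base using (1ℚᵘ)
  open import Data.Fin.Base using (Fin; zero; suc)
  open import Data.List.Base using (List; length; map; applyUpTo)
  open import Data.Nat.Base using (ℕ; zero; suc; _+_; _*_; _^_; _≤_; z≤n; s≤s; NonZero)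
  open import Data.Nat.Properties
  open import Data.Product.Base using (∃-syntax; _×_; _,_; proj₁; proj₂)
  open import Relation.Binary.PropositionalEquality
  open Growth
  open Rates
  open Machines
  open Programs
  open Polynomials

  module _ {d : ℕ} (c : ℝ) (l : ℕ) .{{_ : NonZero l}} (u : ℕ → List (Fin (suc d))) where
    open Construction l u

    length-u-polynomial : (λ n → length (u n)) ∈O[n^ c · 1ℚᵘ ] → Polynomial (λ n → length (u n))
    length-u-polynomial length-u with K , bound ← length-polynomial {c} {λ n → length (u n)} length-u =
      ≤-polynomial split (constᵖ (length (u 0)) +ᵖ constᵖ K *ᵖ (idᵖ ^ᵖ ceiling c))
      where
      -- The growth hypothesis starts at 1, so size 0 gets its own summand.
      split : ∀ n → length (u n) ≤ length (u 0) + K * n ^ ceiling c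
      split zero      = m≤m+n (length (u 0)) _
      split n@(suc _) = ≤-trans (bound n (s≤s z≤n)) (m≤n+m _ (length (u 0)))

    module _ (length-u : Polynomial (λ n → length (u n))) {s k : ℕ} (C : Command (Symbol (suc d) s) (2 + k)) where
      open Program l u C

      loopLength-polynomial : Polynomial (λ n → 2 * length (u n) + (2 + 2 * n))
      loopLength-polynomial = constᵖ 2 *ᵖ length-u +ᵖ (constᵖ 2 +ᵖ constᵖ 2 *ᵖ idᵖ)

      levelTime-polynomial : ∀ {T} → Polynomial T → Polynomial (levelTime T)
      levelTime-polynomial T-polynomial =
        constᵖ 1 +ᵖ (idᵖ *ᵖ constᵖ (7 + B) +ᵖ constᵖ 1 +ᵖ (T-polynomial +ᵖ (constᵖ 1 +ᵖ
        (length-u *ᵖ constᵖ 5 +ᵖ constᵖ 1 +ᵖ (constᵖ 1 +ᵖ (length-u *ᵖ constᵖ 4 +ᵖ constᵖ 1 +ᵖ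
        (((idᵖ +ᵖ T-polynomial) *ᵖ constᵖ 2 +ᵖ constᵖ (suc (2 + k))) +ᵖ (idᵖ *ᵖ constᵖ B *ᵖ constᵖ 4 +ᵖ constᵖ 1))))))))

      reach-polynomial : Polynomial reach
      reach-polynomial = constᵖ 1 +ᵖ constᵖ B *ᵖ (constᵖ B *ᵖ idᵖ)

      mainTime-polynomial : ∀ {D L W} → Polynomial D → Polynomial L → Polynomial W →
                            Polynomial (λ N → mainTime (D N) (L N) (W N) N)
      mainTime-polynomial D-polynomial L-polynomial W-polynomial =
        idᵖ *ᵖ constᵖ 5 +ᵖ constᵖ 1 +ᵖ (constᵖ 1 +ᵖ
        (idᵖ *ᵖ (constᵖ 1 +ᵖ L-polynomial) +ᵖ constᵖ 1 +ᵖ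
        (D-polynomial *ᵖ (W-polynomial *ᵖ constᵖ 6 +ᵖ D-polynomial *ᵖ idᵖ *ᵖ constᵖ 22 +ᵖ constᵖ 7) +ᵖ constᵖ 1 +ᵖ
        (idᵖ *ᵖ constᵖ 5 +ᵖ constᵖ 1 +ᵖ (idᵖ *ᵖ constᵖ 4 +ᵖ constᵖ 1)))))

    τ-polynomialTime : Polynomial (λ n → length (u n)) → PolynomialTime (suc d) u → PolynomialTime (suc d) (applyUpTo τ)
    τ-polynomialTime length-u (s , k , C , a , b , run) =
      s , 9 + k , main , proj₁ time-bound , proj₁ (proj₂ time-bound) , correct
      where
      open Program l u C

      T : ℕ → ℕ
      T n = a * n ^ b + a

      T-polynomial : Polynomial T
      T-polynomial = constᵖ a *ᵖ idᵖ ^ᵖ b +ᵖ constᵖ a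

      loop-polynomial : Polynomial (λ n → 2 * length (u n) + (2 + 2 * n))
      loop-polynomial = loopLength-polynomial length-u C

      level-polynomial : Polynomial (levelTime T)
      level-polynomial = levelTime-polynomial length-u C T-polynomial

      -- `levelTime T` and the lengths of loop words need not be monotone in the size. The bounds
      -- `(2 + n) ^ degree` are, so their values at the largest size bound all levels.
      L W : ℕ → ℕ
      L N = (2 + B * N) ^ degree level-polynomial
      W N = (2 + reach N) ^ degree loop-polynomial

      L-polynomial : Polynomial L
      L-polynomial = (constᵖ 2 +ᵖ constᵖ B *ᵖ idᵖ) ^ᵖ degree level-polynomial

      W-polynomial : Polynomial W
      W-polynomial = (constᵖ 2 +ᵖ reach-polynomial length-u C) ^ᵖ degree loop-polynomial

      time-bound : ∃[ a′ ] ∃[ b′ ] ∀ N → mainTime (reach N) (L N) (W N) N ≤ a′ * N ^ b′ + a′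
      time-bound = polynomial-≤ (mainTime-polynomial length-u C (reach-polynomial length-u C) L-polynomial W-polynomial)

      correct : ∀ N → ∃[ t ] ∃[ σ ] (⟨ main , initial (9 + k) N ⟩⇓[ t ] σ) ×
                output σ ≡ map out (applyUpTo τ N) × t ≤ proj₁ time-bound * N ^ proj₁ (proj₂ time-bound) + proj₁ time-bound
      correct N = halting (λ σ → output σ ≡ map out (applyUpTo τ N)) (proj₂ (proj₂ time-bound) N) (main↓ {T} run {N} {L N} {W N}
        (λ n n≤BN → ≤-trans (bound level-polynomial n) (^-monoˡ-≤ (degree level-polynomial) (+-monoʳ-≤ 2 n≤BN)))
        (λ i B^i≤ → ≤-trans (≤-trans (≤-reflexive (length-loopWord i)) (bound loop-polynomial (B ^ i)))
          (^-monoˡ-≤ (degree loop-polynomial) (+-monoʳ-≤ 2 B^i≤))))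

open import Defs
open import Data.Fin.Base using (Fin)
open import Data.Integer.Base using (+_)
open import Data.List.Base using (List; applyUpTo)
open import Data.Nat.Base using (ℕ; _≤_; NonZero; suc)
open import Data.Product.Base using (∃-syntax; _×_; _,_)
open import Data.Rational.Unnormalised.Base using (1ℚᵘ; _+_; _/_)
open Growth
open Rates
open RunningTimes

theorem4 : (d : ℕ) → 3 ≤ d →
    (c : ℝ) → 1ℚᵘ ≤ᴿ c →
    (l : ℕ) .{{_ : NonZero l}} → 2 ≤ l →
    ((∃[ u ] IsUESFamily d c u) →
    ∃[ τ ] ∃[ p ] IsSUES d τ p × p ∈O[n^ c · 1ℚᵘ + (+ 1 / l) ])
    ×
    ((∃[ u ] IsUESFamily d c u × PolynomialTime d u) →
    ∃[ τ ] ∃[ p ] IsSUES d τ p × p ∈O[n^ c · 1ℚᵘ + (+ 1 / l) ] × PolynomialTime d (applyUpTo τ))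
theorem4 (suc d) _ c 1≤c l _ =
  -- Both parts use the same sequence and cover time; an algorithm for `u` adds one for the
  -- prefixes.
  (λ (u , ues , length-u) → let open Construction l u in
    τ , coverTime , τ-isSUES ues , coverTime-growth c l u 1≤c length-u) ,
  (λ (u , (ues , length-u) , computable) → let open Construction l u in
    τ , coverTime , τ-isSUES ues , coverTime-growth c l u 1≤c length-u ,
    τ-polynomialTime c l u (length-u-polynomial c l u length-u) computable)
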